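{- Let $H$ be a covering $3$-hypergraph with at least two edges. Then $H$ is eulerian.
   Context: A hypergraph $H=(V,E)$ consists of a finite non-empty vertex set $V$ and a finite multiset $E$ of subsets of $V$, called edges (repeated edges allowed; distinct members of the multiset are distinct edges). $H$ is $3$-uniform if every edge has exactly 3 elements. A walk is a sequence $v_0e_1v_1\dots e_mv_m$ with $v_i\in V$, $e_i\in E$, $v_{i-1},v_i\in e_i$, $v_{i-1}\neq v_i$; it is a trail if the $e_i$ are pairwise distinct, and closed if $v_0=v_m$ and $m\ge 2$. An Euler tour is a closed trail traversing every edge exactly once; $H$ is eulerian if it has no edges or admits an Euler tour. A covering $3$-hypergraph is a $3$-uniform hypergraph with at least one edge in which every pair of distinct vertices is contained in at least one edge. -}

module Defs where

open import Data.Nat using (ℕ; suc; _≤_)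
open import Data.Fin using (Fin; zero; suc; inject₁; fromℕ)
open import Data.Fin.Subset using (Subset; _∈_; ∣_∣)
open import Data.Sum using (_⊎_)
open import Data.Product using (Σ; _×_; ∃; ∃-syntax)
open import Relation.Binary.PropositionalEquality using (_≡_; _≢_)
open import Function.Definitions using (Bijective)

-- A hypergraph with vertex set Fin n (non-empty: n = suc k) and an indexed
-- family of m edges (a multiset: distinct indices are distinct edges).
record Hypergraph : Set where
  field
    nV   : ℕ
    m    : ℕ
    edge : Fin m → Subset (suc nV)

  V : Set
  V = Fin (suc nV)

open Hypergraph public

ThreeUniform : Hypergraph → Set
ThreeUniform H = ∀ (e : Fin (m H)) → ∣ edge H e ∣ ≡ 3

Covering3 : Hypergraph → Set
Covering3 H = ThreeUniform H × (1 ≤ m H)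
  × (∀ (u v : V H) → u ≢ v → ∃[ e ] (u ∈ edge H e × v ∈ edge H e))

record ClosedWalk (H : Hypergraph) (k : ℕ) : Set where
  field
    vtx      : Fin (suc k) → V H
    edg      : Fin k → Fin (m H)
    incid₁   : ∀ i → vtx (inject₁ i) ∈ edge H (edg i)
    incid₂   : ∀ i → vtx (suc i) ∈ edge H (edg i)
    distinct : ∀ i → vtx (inject₁ i) ≢ vtx (suc i)
    closed   : vtx zero ≡ vtx (fromℕ k)
    long     : 2 ≤ k

-- Euler tour: a closed trail traversing every edge exactly once, i.e. the
-- edge sequence e₁ … e_k is a bijection onto the edge multiset (so k = m).
EulerTour : Hypergraph → Set
EulerTour H = Σ (ClosedWalk H (m H)) λ W → Bijective _≡_ _≡_ (ClosedWalk.edg W)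

Eulerian : Hypergraph → Set
Eulerian H = m H ≡ 0 ⊎ EulerTour H

{-# OPTIONS --safe #-}
module Submission where

open import Defs hiding (V)
open import Algebra.Bundles using (CommutativeRing)
open import Data.Bool using (Bool; true; false; _xor_; _∧_; if_then_else_)
open import Data.Bool.Properties using
  (xor-∧-commutativeRing; xor-comm; xor-assoc; xor-same; xor-identityʳ; ∧-zeroʳ; ∧-identityʳ; ∧-distribˡ-xor)
open import Data.Bool.Solver using (module xor-∧-Solver)
open import Data.Empty using (⊥; ⊥-elim)
open import Data.Fin using (Fin; zero; suc; _≟_; inject₁; fromℕ; fromℕ<)
open import Data.Fin.Properties using (any?; injective⇒≤; suc-injective)
open import Data.Fin.Subset using (Subset; _∈_; _∉_; ∣_∣; _∪_; _-_; ⁅_⁆)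
open import Data.Fin.Subset.Properties using
  (_∈?_; x∈⁅x⁆; x∈⁅y⁆⇒x≡y; p⊆p∪q; q⊆p∪q; x∈p∪q⁻; p⊂q⇒∣p∣<∣q∣; ∣p∣≤n; p─q⊆p; p─⊥≡p)
open import Data.List using (List; []; _∷_; _++_; length; lookup; map; allFin)
open import Data.List.Membership.DecPropositional using () renaming (_∈?_ to mem?)
open import Data.List.Membership.Propositional using () renaming (_∈_ to _∈ₗ_)
open import Data.List.Membership.Propositional.Properties using (∈-allFin; ∈-lookup; ∈-map⁺)
open import Data.List.Properties using (length-++; length-map)
open import Data.List.Relation.Unary.All as All using (All; []; _∷_)
open import Data.List.Relation.Unary.All.Properties using (¬Any⇒All¬; ++⁺; ++⁻ˡ; ++⁻ʳ; map⁺)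
open import Data.List.Relation.Unary.AllPairs using ([]; _∷_)
open import Data.List.Relation.Unary.Any as Any using (here; there)
open import Data.List.Relation.Unary.Any.Properties using (lookup-index)
open import Data.List.Relation.Unary.Unique.Propositional using (Unique)
import Data.List.Relation.Unary.Unique.Propositional.Properties as Unique
open import Data.Nat using (ℕ; zero; suc; _+_; _≤_; _<_; s≤s; z≤n)
open import Data.Nat.Properties using
  (≤-reflexive; ≤-trans; ≤-antisym; ≤-<-trans; <⇒≱; m≤n⇒m≤1+n; m≤m+n; +-comm; +-suc; +-monoʳ-≤)
open import Data.Product using (Σ; ∃; _×_; _,_; proj₁; proj₂)
open import Data.Sum using (_⊎_; inj₁; inj₂; [_,_]′)
open import Data.Unit using (⊤; tt)
open import Data.Vec using ([]; _∷_; here; there)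
open import Function using (_∘_; id)
open import Function.Definitions using (Bijective)
open import Relation.Binary.Construct.Closure.ReflexiveTransitive using
  (Star; ε; _◅_; _◅◅_; gmap; reverse; _⋆)
open import Relation.Binary.PropositionalEquality
open import Relation.Nullary using (¬_; Dec; yes; no; does)
open import Relation.Nullary.Decidable using (_×-dec_; ¬?; decidable-stable; dec-true; dec-false)
open import Algebra.Properties.CommutativeMonoid.Sum
  (CommutativeRing.+-commutativeMonoid xor-∧-commutativeRing) using (sum; sum-cong-≗; ∑-comm; ∑-distrib-+)
open xor-∧-Solver using (solve; _:=_; _:+_)

-- Choosing two vertices of every triple turns the hypergraph into a multigraph on V, and an Euler
-- tour is a choice whose multigraph has even degrees and all its edges in one component.
--
-- Even degrees: call a choice "toggles" if it is read as the pair of vertices whose parities the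
-- triple can flip.  Every even set of parities inside a component of the toggle graph can be
-- corrected, and redirecting toggles enlarges a component until it misses at most one vertex a,
-- whose parity is then corrected by one triple that the toggle graph can do without.
--
-- Connectivity: let B be a component of an even choice.  Changing choices along a closed sequence of
-- pairs keeps all degrees even, and an even multigraph has no bridges.  If some edge lies outside B,
-- then a bigger component can be obtained: first if a triple avoids B; otherwise any two vertices
-- a, a′ outside B lie in a triple a a′ b with b ∈ B that uses the pair a a′, and the triples through
-- the third vertices b₁, b₂ of such triples a a₁ b₁ and a a₂ b₂ give the change, unless they form a
-- rigid pattern that forces the degree of a to be 3.

-- Sums of bits modulo 2

sum-false : ∀ {m} {t : Fin m → Bool} → (∀ i → t i ≡ false) → sum t ≡ false
sum-false {zero}  h = refl
sum-false {suc m} h = cong₂ _xor_ (h zero) (sum-false (h ∘ suc))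

sum-update : ∀ {m} (i : Fin m) {t t′ : Fin m → Bool} → (∀ j → j ≢ i → t′ j ≡ t j) →
             sum t′ ≡ sum t xor (t i xor t′ i)
sum-update zero {t} {t′} h = trans (cong (t′ zero xor_) (sum-cong-≗ {_} {t′ ∘ suc} {t ∘ suc} (λ j → h (suc j) λ ())))
  (solve 3 (λ x y z → y :+ z := (x :+ z) :+ (x :+ y)) refl (t zero) (t′ zero) (sum (t ∘ suc)))
sum-update (suc i) {t} {t′} h = trans
  (cong₂ _xor_ (h zero λ ()) (sum-update i {t ∘ suc} {t′ ∘ suc} (λ j j≢i → h (suc j) (λ { refl → j≢i refl }))))
  (sym (xor-assoc (t zero) (sum (t ∘ suc)) _))

sum-single : ∀ {m} (i : Fin m) {t : Fin m → Bool} → (∀ j → j ≢ i → t j ≡ false) → sum t ≡ t i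
sum-single {m} i {t} h = trans (sum-update i {λ _ → false} {t} h)
  (cong (_xor t i) (sum-false {m} {λ _ → false} (λ _ → refl)))

-- Lists without repetition, and listing the members of a subset

unique⇒lookup-injective : ∀ {A : Set} {xs : List A} → Unique xs → ∀ {i j} → lookup xs i ≡ lookup xs j → i ≡ j
unique⇒lookup-injective (x∉ ∷ u) {zero}  {zero}  eq = refl
unique⇒lookup-injective (x∉ ∷ u) {zero}  {suc j} eq = ⊥-elim (All.lookup x∉ (∈-lookup j) eq)
unique⇒lookup-injective (x∉ ∷ u) {suc i} {zero}  eq = ⊥-elim (All.lookup x∉ (∈-lookup i) (sym eq))
unique⇒lookup-injective (x∉ ∷ u) {suc i} {suc j} eq = cong suc (unique⇒lookup-injective u eq)

record Enumeration {n} (s : Subset n) : Set where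
  field
    {list}   : List (Fin n)
    unique   : Unique list
    sound    : All (_∈ s) list
    complete : ∀ {x} → x ∈ s → x ∈ₗ list
    size     : length list ≡ ∣ s ∣

enumerate : ∀ {n} (s : Subset n) → Enumeration s
enumerate [] = record { unique = [] ; sound = [] ; complete = λ () ; size = refl }
enumerate (false ∷ s) = record
  { unique   = Unique.map⁺ suc-injective unique
  ; sound    = map⁺ (All.map there sound)
  ; complete = λ { (there x∈) → ∈-map⁺ suc (complete x∈) }
  ; size     = trans (length-map suc list) size
  }
  where open Enumeration (enumerate s)
enumerate (true ∷ s) = record
  { unique   = map⁺ (All.universal (λ _ ()) list) ∷ Unique.map⁺ suc-injective unique
  ; sound    = here ∷ map⁺ (All.map there sound)
  ; complete = λ { here → here refl ; (there x∈) → there (∈-map⁺ suc (complete x∈)) }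
  ; size     = cong suc (trans (length-map suc list) size)
  }
  where open Enumeration (enumerate s)

-- Removing entries from a sum and elements from a subset

xor-cancel : ∀ x y → x ≡ x xor (y xor y)
xor-cancel = solve 2 (λ x y → x := x :+ (y :+ y)) refl

xor-telescope : ∀ w x y z → (w xor (x xor y)) xor (y xor z) ≡ w xor (x xor z)
xor-telescope = solve 4 (λ w x y z → (w :+ (x :+ y)) :+ (y :+ z) := w :+ (x :+ z)) refl

erase : ∀ {m} → Fin m → (Fin m → Bool) → Fin m → Bool
erase i t j = if does (j ≟ i) then false else t j

erase-other : ∀ {m} {i j : Fin m} t → j ≢ i → erase i t j ≡ t j
erase-other {i = i} {j} t j≢i rewrite dec-false (j ≟ i) j≢i = refl

erase-true : ∀ {m} {i j : Fin m} t → erase i t j ≡ true → j ≢ i × t j ≡ true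
erase-true {i = i} {j} t eq with j ≟ i | eq
... | no j≢i | tj = j≢i , tj
... | yes _  | ()

sum-erase : ∀ {m} (i : Fin m) t → sum (erase i t) ≡ sum t xor t i
sum-erase i t = trans (sum-update i {t} {erase i t} (λ j → erase-other t)) (cong (sum t xor_) (trans
  (cong (λ b → t i xor (if b then false else t i)) (dec-true (i ≟ i) refl)) (xor-identityʳ (t i))))

sum-true : ∀ {m} (t : Fin m → Bool) → sum t ≡ true → ∃ λ i → t i ≡ true
sum-true {suc m} t eq with t zero in eq₀
... | true  = zero , eq₀
... | false with sum-true (t ∘ suc) eq
... | i , eq₁ = suc i , eq₁

xor-list : ∀ {m} → (Fin m → Bool) → List (Fin m) → Bool
xor-list t []       = false
xor-list t (e ∷ es) = t e xor xor-list t es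

xor-list-cong : ∀ {m} {t t′ : Fin m → Bool} {es} → All (λ e → t e ≡ t′ e) es → xor-list t es ≡ xor-list t′ es
xor-list-cong []         = refl
xor-list-cong (eq ∷ eqs) = cong₂ _xor_ eq (xor-list-cong eqs)

-- Erasing the listed positions one by one subtracts their entries, so the remaining sum is odd and
-- has a `true` entry. Applied to the edges at a vertex, this finds an edge outside a given list by
-- parity.
odd-rest : ∀ {m} (t : Fin m → Bool) {es} → Unique es → sum t xor xor-list t es ≡ true →
           ∃ λ e → All (e ≢_) es × t e ≡ true
odd-rest t {[]} [] odd with sum-true t (trans (sym (xor-identityʳ (sum t))) odd)
... | e , te = e , [] , te
odd-rest t {i ∷ es} (i∉ ∷ u) odd with odd-rest (erase i t) u (begin
    sum (erase i t) xor xor-list (erase i t) es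
      ≡⟨ cong₂ _xor_ (sum-erase i t) (xor-list-cong (All.map (λ i≢e → erase-other t (i≢e ∘ sym)) i∉)) ⟩
    (sum t xor t i) xor xor-list t es
      ≡⟨ xor-assoc (sum t) (t i) _ ⟩
    sum t xor xor-list t (i ∷ es)
      ≡⟨ odd ⟩
    true ∎)
  where open ≡-Reasoning
... | e , e∉ , te with erase-true t te
... | e≢i , te′ = e , e≢i ∷ e∉ , te′

∣p∣≤1+∣p-x∣ : ∀ {n} (p : Subset n) x → ∣ p ∣ ≤ suc ∣ p - x ∣
∣p∣≤1+∣p-x∣ (true ∷ p)  zero    = s≤s (≤-reflexive (cong ∣_∣ (sym (p─⊥≡p p))))
∣p∣≤1+∣p-x∣ (false ∷ p) zero    = m≤n⇒m≤1+n (≤-reflexive (cong ∣_∣ (sym (p─⊥≡p p))))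
∣p∣≤1+∣p-x∣ (true ∷ p)  (suc x) = s≤s (∣p∣≤1+∣p-x∣ p x)
∣p∣≤1+∣p-x∣ (false ∷ p) (suc x) = ∣p∣≤1+∣p-x∣ p x

x∉p-x : ∀ {n} (p : Subset n) {x} → x ∉ p - x
x∉p-x (true ∷ p)  {zero}  ()
x∉p-x (false ∷ p) {zero}  ()
x∉p-x (_ ∷ p) {suc x} (there x∈) = x∉p-x p x∈

-- Triples with a chosen pair

record Tri {n} (s : Subset n) (u v w : Fin n) : Set where
  constructor mkTri
  field
    u∈  : u ∈ s
    v∈  : v ∈ s
    w∈  : w ∈ s
    u≢v : u ≢ v
    u≢w : u ≢ w
    v≢w : v ≢ w
    only : ∀ {x} → x ∈ s → x ≡ u ⊎ x ≡ v ⊎ x ≡ w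

rotate : ∀ {n} {s : Subset n} {u v w} → Tri s u v w → Tri s v w u
rotate (mkTri u∈ v∈ w∈ u≢v u≢w v≢w only) =
  mkTri v∈ w∈ u∈ v≢w (u≢v ∘ sym) (u≢w ∘ sym)
    λ x∈ → [ inj₂ ∘ inj₂ , [ inj₁ , inj₂ ∘ inj₁ ]′ ]′ (only x∈)

flip : ∀ {n} {s : Subset n} {u v w} → Tri s u v w → Tri s v u w
flip (mkTri u∈ v∈ w∈ u≢v u≢w v≢w only) =
  mkTri v∈ u∈ w∈ (u≢v ∘ sym) v≢w u≢w
    λ x∈ → [ inj₂ ∘ inj₁ , [ inj₁ , inj₂ ∘ inj₂ ]′ ]′ (only x∈)

-- The order p, q, w of a triple encodes the choice of the pair p, q.
record Order {n} (s : Subset n) : Set where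
  constructor order
  field
    {p q w} : Fin n
    tri     : Tri s p q w
open Order

three : ∀ {n} (s : Subset n) → ∣ s ∣ ≡ 3 → Order s
three s ∣s∣≡3 with enumerate s
... | record { list = list ; unique = unique ; sound = sound ; complete = complete ; size = size }
  with list | trans size ∣s∣≡3 | unique | sound
... | a ∷ b ∷ c ∷ [] | refl | (a≢b ∷ a≢c ∷ []) ∷ (b≢c ∷ []) ∷ [] ∷ [] | a∈ ∷ b∈ ∷ c∈ ∷ [] =
  order (mkTri a∈ b∈ c∈ a≢b a≢c b≢c λ x∈ → which (complete x∈))
  where
  which : ∀ {x} → x ∈ₗ a ∷ b ∷ c ∷ [] → x ≡ a ⊎ x ≡ b ⊎ x ≡ c
  which (here x≡a)                 = inj₁ x≡a
  which (there (here x≡b))         = inj₂ (inj₁ x≡b)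
  which (there (there (here x≡c))) = inj₂ (inj₂ x≡c)

data Ends {n} {s : Subset n} (o : Order s) : Fin n → Fin n → Set where
  fwd : Ends o (p o) (q o)
  bwd : Ends o (q o) (p o)

ends-cases : ∀ {n} {s : Subset n} (o : Order s) {u v} → u ∈ s → v ∈ s → u ≢ v →
  ∃ λ z → Tri s u v z × (Ends o u v ⊎ Ends o u z ⊎ Ends o v z)
ends-cases (order t) u∈ v∈ u≢v with Tri.only t u∈ | Tri.only t v∈
... | inj₁ refl        | inj₁ refl        = ⊥-elim (u≢v refl)
... | inj₁ refl        | inj₂ (inj₁ refl) = _ , t , inj₁ fwd
... | inj₁ refl        | inj₂ (inj₂ refl) = _ , flip (rotate (rotate t)) , inj₂ (inj₁ fwd)
... | inj₂ (inj₁ refl) | inj₁ refl        = _ , flip t , inj₁ bwd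
... | inj₂ (inj₁ refl) | inj₂ (inj₁ refl) = ⊥-elim (u≢v refl)
... | inj₂ (inj₁ refl) | inj₂ (inj₂ refl) = _ , rotate t , inj₂ (inj₁ bwd)
... | inj₂ (inj₂ refl) | inj₁ refl        = _ , rotate (rotate t) , inj₂ (inj₂ fwd)
... | inj₂ (inj₂ refl) | inj₂ (inj₁ refl) = _ , flip (rotate t) , inj₂ (inj₂ bwd)
... | inj₂ (inj₂ refl) | inj₂ (inj₂ refl) = ⊥-elim (u≢v refl)

-- States and swaps

module Orderings {n m : ℕ} (edge : Fin m → Subset n) where

  V E : Set
  V = Fin n
  E = Fin m

  State : Set
  State = ∀ e → Order (edge e)

  -- A record instead of a synonym for `Ends (f e) u v`, so that `f` and `e` can be inferred:
  -- unification does not recover them from the application `f e`.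
  record Joins (f : State) (e : E) (u v : V) : Set where
    constructor joins
    field ends : Ends (f e) u v
  open Joins

  joins? : ∀ f e u v → Dec (Joins f e u v)
  joins? f e u v with p (f e) ≟ u ×-dec q (f e) ≟ v | p (f e) ≟ v ×-dec q (f e) ≟ u
  ... | yes (refl , refl) | _                 = yes (joins fwd)
  ... | no _              | yes (refl , refl) = yes (joins bwd)
  ... | no ¬a             | no ¬b             =
    no λ { (joins fwd) → ¬a (refl , refl) ; (joins bwd) → ¬b (refl , refl) }

  joins-sym : ∀ {f e u v} → Joins f e u v → Joins f e v u
  joins-sym (joins fwd) = joins bwd
  joins-sym (joins bwd) = joins fwd

  joins-unique : ∀ {f e u v x y} → Joins f e u v → Joins f e x y → (u ≡ x × v ≡ y) ⊎ (u ≡ y × v ≡ x)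
  joins-unique (joins fwd) (joins fwd) = inj₁ (refl , refl)
  joins-unique (joins fwd) (joins bwd) = inj₂ (refl , refl)
  joins-unique (joins bwd) (joins fwd) = inj₂ (refl , refl)
  joins-unique (joins bwd) (joins bwd) = inj₁ (refl , refl)

  joins-∈ : ∀ {f e u v} → Joins f e u v → u ∈ edge e
  joins-∈ {f} {e} (joins fwd) = Tri.u∈ (tri (f e))
  joins-∈ {f} {e} (joins bwd) = Tri.v∈ (tri (f e))

  joins-≢ : ∀ {f e u v} → Joins f e u v → u ≢ v
  joins-≢ {f} {e} (joins fwd) = Tri.u≢v (tri (f e))
  joins-≢ {f} {e} (joins bwd) = Tri.u≢v (tri (f e)) ∘ sym

  joins-cong : ∀ {f g e u v} → g e ≡ f e → Joins f e u v → Joins g e u v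
  joins-cong eq (joins j) = joins (subst (λ o → Ends o _ _) (sym eq) j)

  pair-cases : ∀ (f : State) {e u v} → u ∈ edge e → v ∈ edge e → u ≢ v →
    ∃ λ z → Tri (edge e) u v z × (Joins f e u v ⊎ Joins f e u z ⊎ Joins f e v z)
  pair-cases f {e} u∈ v∈ u≢v with ends-cases (f e) u∈ v∈ u≢v
  ... | z , t , inj₁ j        = z , t , inj₁ (joins j)
  ... | z , t , inj₂ (inj₁ j) = z , t , inj₂ (inj₁ (joins j))
  ... | z , t , inj₂ (inj₂ j) = z , t , inj₂ (inj₂ (joins j))

  crossing : State → (V → Bool) → E → Bool
  crossing f S e = S (p (f e)) xor S (q (f e))

  cut : State → (V → Bool) → Bool
  cut f S = sum (crossing f S)

  joins-crossing : ∀ {f e u v} S → Joins f e u v → crossing f S e ≡ S u xor S v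
  joins-crossing S (joins fwd) = refl
  joins-crossing {f} {e} S (joins bwd) = xor-comm (S (p (f e))) (S (q (f e)))

  -- Phrased with all cuts instead of only the degrees, which are the cuts of single vertices, so
  -- that the absence of bridges is immediate. `degrees-even` recovers it from the degrees.
  Even : State → Set
  Even f = ∀ S → cut f S ≡ false

  upd : State → (e : E) → Order (edge e) → State
  upd f e o e′ with e ≟ e′
  ... | yes refl = o
  ... | no  _    = f e′

  upd-same : ∀ f e o → upd f e o e ≡ o
  upd-same f e o with e ≟ e
  ... | yes refl = refl
  ... | no  e≢e  = ⊥-elim (e≢e refl)

  upd-other : ∀ f {e e′} o → e′ ≢ e → upd f e o e′ ≡ f e′
  upd-other f {e} {e′} o e′≢e with e ≟ e′
  ... | yes refl = ⊥-elim (e′≢e refl)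
  ... | no  _    = refl

  upd-joins : ∀ f {e u v w} (t : Tri (edge e) u v w) → Joins (upd f e (order t)) e u v
  upd-joins f {e} t = joins (subst (λ o → Ends o _ _) (sym (upd-same f e (order t))) fwd)

  cut-upd : ∀ f e o S → cut (upd f e o) S ≡ cut f S xor (crossing f S e xor (S (p o) xor S (q o)))
  cut-upd f e o S = trans
    (sum-update e (λ j j≢e → cong (λ c → S (p c) xor S (q c)) (upd-other f o j≢e)))
    (cong (λ c → cut f S xor (crossing f S e xor (S (p c) xor S (q c)))) (upd-same f e o))

  -- A swap along {a , b} replaces the pair chosen by a triple a b z, from a z to b z or back.
  record Swap (f : State) (a b : V) : Set where
    constructor mkSwap
    field
      {at}  : E
      {piv} : V
      shape : Tri (edge at) a b piv
      dir   : Joins f at a piv ⊎ Joins f at b piv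

    target : Order (edge at)
    target = [ (λ _ → order (flip (rotate (rotate (flip shape)))))
             , (λ _ → order (flip (rotate (rotate shape)))) ]′ dir

    gained : V
    gained = [ (λ _ → b) , (λ _ → a) ]′ dir

    -- The old and the new pair both contain `piv`, whose contribution cancels modulo 2.
    shift : ∀ S → crossing f S at xor (S (p target) xor S (q target)) ≡ S a xor S b
    shift S with dir
    ... | inj₁ j rewrite joins-crossing S j =
      solve 3 (λ x y z → (x :+ z) :+ (y :+ z) := x :+ y) refl (S a) (S b) (S piv)
    ... | inj₂ j rewrite joins-crossing S j =
      solve 3 (λ x y z → (y :+ z) :+ (x :+ z) := x :+ y) refl (S a) (S b) (S piv)
  open Swap

  -- All swaps of a sequence refer to the initial state `f`. Under `Distinct` this is harmless,
  -- because no swap then touches a triple that another one uses.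
  Swaps : State → V → V → Set
  Swaps f = Star (Swap f)

  apply : ∀ {f a b} → Swaps f a b → State
  apply {f} ε        = f
  apply     (s ◅ ss) = upd (apply ss) (at s) (target s)

  Avoids : ∀ {f a b} → E → Swaps f a b → Set
  Avoids e ε        = ⊤
  Avoids e (s ◅ ss) = e ≢ at s × Avoids e ss

  Distinct : ∀ {f a b} → Swaps f a b → Set
  Distinct ε        = ⊤
  Distinct (s ◅ ss) = Avoids (at s) ss × Distinct ss

  apply-avoids : ∀ {f a b e} (ss : Swaps f a b) → Avoids e ss → apply ss e ≡ f e
  apply-avoids ε        av        = refl
  apply-avoids (s ◅ ss) (≢s , av) = trans (upd-other (apply ss) (target s) ≢s) (apply-avoids ss av)

  Gains : ∀ {f a b} → State → Swaps f a b → Set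
  Gains g ε        = ⊤
  Gains g (s ◅ ss) = Joins g (at s) (gained s) (piv s) × Gains g ss

  gains-upd : ∀ {f a b g e o} (ss : Swaps f a b) → Avoids e ss → Gains g ss → Gains (upd g e o) ss
  gains-upd ε        av        gs       = tt
  gains-upd {g = g} {o = o} (s ◅ ss) (≢s , av) (j , gs) =
    joins-cong (upd-other g o (≢s ∘ sym)) j , gains-upd ss av gs

  gains : ∀ {f a b} (ss : Swaps f a b) → Distinct ss → Gains (apply ss) ss
  gains ε        d        = tt
  gains (mkSwap t (inj₁ j) ◅ ss) (av , d) = upd-joins (apply ss) _ , gains-upd ss av (gains ss d)
  gains (mkSwap t (inj₂ j) ◅ ss) (av , d) = upd-joins (apply ss) _ , gains-upd ss av (gains ss d)

  -- The effects of successive swaps telescope to the two ends of the sequence. In particular, a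
  -- closed sequence changes no parity.
  cut-apply : ∀ {f a b} (ss : Swaps f a b) → Distinct ss → ∀ S → cut (apply ss) S ≡ cut f S xor (S a xor S b)
  cut-apply {f} {a} ε d S = xor-cancel (cut f S) (S a)
  cut-apply {f} {a} {b} (_◅_ {j = c} s ss) (av , d) S = begin
    cut (apply ss′) S
      ≡⟨ cut-upd (apply ss) (at s) (target s) S ⟩
    cut (apply ss) S xor (crossing (apply ss) S (at s) xor (S (p (target s)) xor S (q (target s))))
      ≡⟨ cong (λ o → cut (apply ss) S xor
                ((S (p o) xor S (q o)) xor (S (p (target s)) xor S (q (target s))))) (apply-avoids ss av) ⟩
    cut (apply ss) S xor (crossing f S (at s) xor (S (p (target s)) xor S (q (target s))))
      ≡⟨ cong₂ _xor_ (cut-apply ss d S) (shift s S) ⟩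
    (cut f S xor (S c xor S b)) xor (S a xor S c)
      ≡⟨ solve 4 (λ w x y z → (w :+ (z :+ y)) :+ (x :+ z) := w :+ (x :+ y)) refl (cut f S) (S a) (S b) (S c) ⟩
    cut f S xor (S a xor S b) ∎
    where
    open ≡-Reasoning
    ss′ = s ◅ ss

  even-apply : ∀ {f a} (ss : Swaps f a a) → Distinct ss → Even f → Even (apply ss)
  even-apply {f} {a} ss d ev S = trans (cut-apply ss d S) (cong₂ _xor_ (ev S) (xor-same (S a)))

  -- Components

  Link : State → (E → Set) → V → V → Set
  Link f P u v = ∃ λ e → P e × Joins f e u v

  Reach : State → (E → Set) → V → V → Set
  Reach f P = Star (Link f P)

  link : ∀ {f} {P : E → Set} {e u v} → P e → Joins f e u v → Reach f P u v
  link Pe j = (_ , Pe , j) ◅ ε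

  reach-sym : ∀ {f} {P : E → Set} {u v} → Reach f P u v → Reach f P v u
  reach-sym = reverse λ { (e , Pe , j) → e , Pe , joins-sym j }

  reach-map : ∀ {f g} {P Q : E → Set} → (∀ {e x y} → P e → Joins f e x y → Reach g Q x y) →
              ∀ {u v} → Reach f P u v → Reach g Q u v
  reach-map h = (λ { (e , Pe , j) → h Pe j }) ⋆

  Misses : State → V → E → Set
  Misses f b e = ∀ {y} → ¬ Joins f e b y

  -- The vertex `tip` was reached last, so that removing it does not disconnect the component.
  record Component (f : State) (P : E → Set) (r : V) : Set where
    field
      {B}    : Subset n
      root   : r ∈ B
      closed : ∀ {e u v} → P e → Joins f e u v → u ∈ B → v ∈ B
      conn   : ∀ {u} → u ∈ B → Reach f P r u
      {tip}  : V
      tip∈   : tip ∈ B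
      noncut : ∀ {u v} → u ∈ B → v ∈ B → u ≢ tip → v ≢ tip → Reach f (λ e → P e × Misses f tip e) u v
      alone  : tip ≡ r → ∀ {u} → u ∈ B → u ≡ r

    conn₂ : ∀ {u v} → u ∈ B → v ∈ B → Reach f P u v
    conn₂ u∈ v∈ = reach-sym (conn u∈) ◅◅ conn v∈

  module Growth (f : State) {P : E → Set} (P? : ∀ e → Dec (P e)) (r : V) where

    Inside : Subset n → V → V → Set
    Inside S u v = u ∈ S × v ∈ S × Link f P u v

    record Grown (S : Subset n) : Set where
      field
        root   : r ∈ S
        inside : ∀ {u} → u ∈ S → Star (Inside S) r u
        tip    : V
        tip∈   : tip ∈ S
        noncut : ∀ {u v} → u ∈ S → v ∈ S → u ≢ tip → v ≢ tip → Reach f (λ e → P e × Misses f tip e) u v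
        alone  : tip ≡ r → ∀ {u} → u ∈ S → u ≡ r

    single : Grown ⁅ r ⁆
    single = record
      { root = x∈⁅x⁆ r
      ; inside = λ u∈ → subst (Star (Inside ⁅ r ⁆) r) (sym (x∈⁅y⁆⇒x≡y r u∈)) ε
      ; tip = r
      ; tip∈ = x∈⁅x⁆ r
      ; noncut = λ u∈ _ u≢r → ⊥-elim (u≢r (x∈⁅y⁆⇒x≡y r u∈))
      ; alone = λ _ → x∈⁅y⁆⇒x≡y r
      }

    extend : ∀ {S u v} → Grown S → u ∈ S → v ∉ S → Link f P u v → Grown (S ∪ ⁅ v ⁆)
    extend {S} {u} {v} G u∈ v∉ l = record
      { root = old root
      ; inside = λ w∈ → inside′ (x∈p∪q⁻ S _ w∈)
      ; tip = v
      ; tip∈ = new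
      -- Older vertices are joined to the root by links within `S`, and none of these uses the new
      -- vertex `v`.
      ; noncut = λ x∈ y∈ x≢v y≢v →
          reach-sym (toReach (inside (older x∈ x≢v))) ◅◅ toReach (inside (older y∈ y≢v))
      ; alone = λ { refl → ⊥-elim (v∉ root) }
      }
      where
      open Grown G using (root; inside)
      old : ∀ {w} → w ∈ S → w ∈ S ∪ ⁅ v ⁆
      old = p⊆p∪q _
      new : v ∈ S ∪ ⁅ v ⁆
      new = q⊆p∪q S _ (x∈⁅x⁆ v)
      older : ∀ {w} → w ∈ S ∪ ⁅ v ⁆ → w ≢ v → w ∈ S
      older w∈ w≢v with x∈p∪q⁻ S _ w∈
      ... | inj₁ w∈S = w∈S
      ... | inj₂ w∈v = ⊥-elim (w≢v (x∈⁅y⁆⇒x≡y v w∈v))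
      widen : ∀ {x y} → Inside S x y → Inside (S ∪ ⁅ v ⁆) x y
      widen (x∈ , y∈ , l) = old x∈ , old y∈ , l
      inside′ : ∀ {w} → w ∈ S ⊎ w ∈ ⁅ v ⁆ → Star (Inside (S ∪ ⁅ v ⁆)) r w
      inside′ (inj₁ w∈) = gmap id widen (inside w∈)
      inside′ (inj₂ w∈) with x∈⁅y⁆⇒x≡y v w∈
      ... | refl = gmap id widen (inside u∈) ◅◅ ((old u∈ , new , l) ◅ ε)
      misses : ∀ {e x y} → x ∈ S → y ∈ S → Joins f e x y → Misses f v e
      misses x∈ y∈ j k with joins-unique j k
      ... | inj₁ (refl , _) = v∉ x∈
      ... | inj₂ (_ , refl) = v∉ y∈
      toReach : ∀ {x y} → Star (Inside S) x y → Reach f (λ e → P e × Misses f v e) x y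
      toReach = gmap id λ { (x∈ , y∈ , (e , Pe , j)) → e , (Pe , misses x∈ y∈ j) , j }

    -- `k` is fuel: every round adds a vertex, and the bound rules out that another one can be added
    -- when `k` is zero.
    grow : ∀ k S → n ≤ k + ∣ S ∣ → Grown S → Component f P r
    grow k S bound G with any? (λ u → any? λ v → any? λ e →
                                   (u ∈? S) ×-dec ¬? (v ∈? S) ×-dec P? e ×-dec joins? f e u v)
    ... | no stuck = record
      { root = root
      ; closed = λ {e} {u} {v} Pe j u∈ → decidable-stable (v ∈? S) λ v∉ → stuck (u , v , e , u∈ , v∉ , Pe , j)
      ; conn = λ u∈ → gmap id (λ { (_ , _ , l) → l }) (inside u∈)
      ; tip∈ = tip∈
      ; noncut = noncut
      ; alone = alone
      }
      where open Grown G
    grow zero S bound G | yes (u , v , e , u∈ , v∉ , _) = ⊥-elim (<⇒≱ larger (≤-trans (∣p∣≤n (S ∪ ⁅ v ⁆)) bound))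
      where
      larger : ∣ S ∣ < ∣ S ∪ ⁅ v ⁆ ∣
      larger = p⊂q⇒∣p∣<∣q∣ (p⊆p∪q _ , v , q⊆p∪q S _ (x∈⁅x⁆ v) , v∉)
    grow (suc k) S bound G | yes (u , v , e , u∈ , v∉ , Pe , j) =
      grow k (S ∪ ⁅ v ⁆)
        (≤-trans bound (subst (_≤ k + ∣ S ∪ ⁅ v ⁆ ∣) (+-suc k ∣ S ∣)
          (+-monoʳ-≤ k (p⊂q⇒∣p∣<∣q∣ (p⊆p∪q _ , v , q⊆p∪q S _ (x∈⁅x⁆ v) , v∉)))))
        (extend G u∈ v∉ (e , Pe , j))

  component : ∀ f {P : E → Set} (P? : ∀ e → Dec (P e)) r → Component f P r
  component f P? r = grow n ⁅ r ⁆ (m≤m+n n _) single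
    where open Growth f P? r

  -- An even cut cannot consist of the edge e alone.
  nonbridge : ∀ {f e u v} → Even f → Joins f e u v → Reach f (_≢ e) u v
  nonbridge {f} {e} {u} {v} ev j = go (v ∈? B)
    where
    C = component f (λ e′ → ¬? (e′ ≟ e)) u
    open Component C
    S : V → Bool
    S x = does (x ∈? B)
    agree : ∀ {x y} → (x ∈ B → y ∈ B) → (y ∈ B → x ∈ B) → S x xor S y ≡ false
    agree {x} {y} to from with x ∈? B | y ∈? B
    ... | yes _  | yes _  = refl
    ... | no _   | no _   = refl
    ... | yes x∈ | no y∉  = ⊥-elim (y∉ (to x∈))
    ... | no x∉  | yes y∈ = ⊥-elim (x∉ (from y∈))
    go : Dec (v ∈ B) → Reach f (_≢ e) u v
    go (yes v∈) = conn v∈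
    go (no v∉) = ⊥-elim (true≢false (trans (sym one) (ev S)))
      where
      true≢false : true ≢ false
      true≢false ()
      one : cut f S ≡ true
      one = trans (sum-single e (λ e′ ≢e → agree (closed ≢e (joins fwd)) (closed ≢e (joins bwd))))
        (trans (joins-crossing S j) (cong₂ _xor_ (dec-true (u ∈? B) root) (dec-false (v ∈? B) v∉)))

  -- Enlarging a component of an even state

  Every : E → Set
  Every _ = ⊤

  every? : ∀ e → Dec (Every e)
  every? _ = yes tt

  reach-closed : ∀ {f P r u v} (C : Component f P r) → u ∈ Component.B C → Reach f P u v → v ∈ Component.B C
  reach-closed C u∈ ε = u∈
  reach-closed C u∈ ((e , Pe , j) ◅ ρ) = reach-closed C (Component.closed C Pe j u∈) ρ

  larger : ∀ {f g P Q r x w} (C : Component f P r) (C′ : Component g Q x) →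
           (∀ {u} → u ∈ Component.B C → Reach g Q x u) → w ∉ Component.B C → Reach g Q x w →
           ∣ Component.B C ∣ < ∣ Component.B C′ ∣
  larger C C′ all w∉ xw = p⊂q⇒∣p∣<∣q∣
    ((λ u∈ → reach-closed C′ (Component.root C′) (all u∈)) , _ , reach-closed C′ (Component.root C′) xw , w∉)

  -- At most `y` is lost, while `w` and `z` are new: `w` makes up for `y`, and `z` makes the
  -- inequality strict.
  larger-but : ∀ {f g P Q r x y w z} (C : Component f P r) (C′ : Component g Q x) →
               (∀ {u} → u ∈ Component.B C → u ≢ y → Reach g Q x u) →
               w ≢ z → w ∉ Component.B C → z ∉ Component.B C → Reach g Q x w → Reach g Q x z →
               ∣ Component.B C ∣ < ∣ Component.B C′ ∣
  larger-but {y = y} {w} {z} C C′ all w≢z w∉ z∉ xw xz =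
    ≤-<-trans (∣p∣≤1+∣p-x∣ B y)
      (≤-<-trans (p⊂q⇒∣p∣<∣q∣ (p⊆p∪q _ , w , q⊆p∪q (B - y) _ (x∈⁅x⁆ w) , w∉ ∘ p─q⊆p B ⁅ y ⁆))
        (p⊂q⇒∣p∣<∣q∣ (into , z , reach-closed C′ (root C′) xz , not-z)))
    where
    open Component using (root)
    B = Component.B C
    into : ∀ {u} → u ∈ (B - y) ∪ ⁅ w ⁆ → u ∈ Component.B C′
    into u∈ with x∈p∪q⁻ (B - y) _ u∈
    ... | inj₁ u∈B-y = reach-closed C′ (root C′) (all (p─q⊆p B ⁅ y ⁆ u∈B-y) λ { refl → x∉p-x B u∈B-y })
    ... | inj₂ u∈w with x∈⁅y⁆⇒x≡y w u∈w
    ... | refl = reach-closed C′ (root C′) xw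
    not-z : z ∉ (B - y) ∪ ⁅ w ⁆
    not-z z∈ with x∈p∪q⁻ (B - y) _ z∈
    ... | inj₁ z∈B-y = z∉ (p─q⊆p B ⁅ y ⁆ z∈B-y)
    ... | inj₂ z∈w = w≢z (sym (x∈⁅y⁆⇒x≡y w z∈w))

  apart : ∀ {e e′ u v w x} → Tri (edge e) u v w → x ∈ edge e′ → x ≢ u → x ≢ v → x ≢ w → e′ ≢ e
  apart t x∈ x≢u x≢v x≢w refl with Tri.only t x∈
  ... | inj₁ x≡u        = x≢u x≡u
  ... | inj₂ (inj₁ x≡v) = x≢v x≡v
  ... | inj₂ (inj₂ x≡w) = x≢w x≡w

  -- Paths that survive a change of choices

  keep : ∀ {f a b u v} {Q : E → Set} (ss : Swaps f a b) → (∀ {e} → Q e → Avoids e ss) →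
         Reach f Q u v → Reach (apply ss) Every u v
  keep ss av = reach-map λ Qe j → link tt (joins-cong (apply-avoids ss (av Qe)) j)

  misses-≢ : ∀ {f b e e′ y} → Misses f b e → Joins f e′ b y → e ≢ e′
  misses-≢ miss j refl = miss j

  -- Each use of `s` on the path is replaced by a detour, since `s` is not a bridge.
  avoid : ∀ {f s x y u v} → Even f → Joins f s x y → Reach f Every u v → Reach f (_≢ s) u v
  avoid {s = s} ev k = reach-map λ {e} _ j → go j (e ≟ s)
    where
    go : ∀ {e u v} → Joins _ e u v → Dec (e ≡ s) → Reach _ (_≢ s) u v
    go j (yes refl) = nonbridge ev j
    go j (no e≢s)   = link e≢s j

  -- Just before its first use of `t`, the path stands at `q` or at `y`; without such a use it ends
  -- at `q`.
  split : ∀ {f t q y u} {Q : E → Set} → Joins f t q y → Reach f Q u q →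
          Reach f (λ e → Q e × e ≢ t) u q ⊎ Reach f (λ e → Q e × e ≢ t) u y
  split k ε = inj₁ ε
  split {t = t} k ((e , Qe , j) ◅ ρ) with e ≟ t
  ... | yes refl with joins-unique k j
  ...   | inj₁ (refl , _) = inj₁ ε
  ...   | inj₂ (_ , refl) = inj₂ ε
  split {t = t} k ((e , Qe , j) ◅ ρ) | no e≢t with split k ρ
  ...   | inj₁ σ = inj₁ ((e , (Qe , e≢t) , j) ◅ σ)
  ...   | inj₂ σ = inj₂ ((e , (Qe , e≢t) , j) ◅ σ)

  δ : V → V → Bool
  δ a x = does (x ≟ a)

  crossing-joins : ∀ f {e a} → crossing f (δ a) e ≡ true → ∃ λ y → Joins f e a y
  crossing-joins f {e} {a} eq with p (f e) ≟ a | q (f e) ≟ a | eq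
  ... | yes refl | _        | _  = _ , joins fwd
  ... | no _     | yes refl | _  = _ , joins bwd
  ... | no _     | no _     | ()

  Covering : Set
  Covering = ∀ u v → u ≢ v → ∃ λ e → u ∈ edge e × v ∈ edge e

  module Boundary {f : State} {r : V} (C : Component f Every r) where
    open Component C

    ∈≢∉ : ∀ {x y} → x ∈ B → y ∉ B → x ≢ y
    ∈≢∉ x∈ y∉ refl = y∉ x∈

    ∉≢∈ : ∀ {x y} → x ∉ B → y ∈ B → x ≢ y
    ∉≢∈ x∉ y∈ refl = x∉ y∈

    closed∉ : ∀ {e u v} → Joins f e u v → u ∉ B → v ∉ B
    closed∉ j u∉ v∈ = u∉ (closed tt (joins-sym j) v∈)

    Within Without : E → Set
    Within e = ∀ {x y} → Joins f e x y → x ∈ B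
    Without e = ∀ {x y} → Joins f e x y → x ∉ B

    within-≢ : ∀ {e s x y} → Within e → Joins f s x y → x ∉ B → e ≢ s
    within-≢ w j x∉ refl = x∉ (w j)

    without-≢ : ∀ {e s x y} → Without e → Joins f s x y → x ∈ B → e ≢ s
    without-≢ w j x∈ refl = w j x∈

    stay : ∀ {u v} {Q : E → Set} → u ∈ B → Reach f Q u v → Reach f (λ e → Q e × Within e) u v
    stay u∈ ε = ε
    stay {Q = Q} u∈ ((e , Qe , j) ◅ ρ) = (e , (Qe , within) , j) ◅ stay (closed tt j u∈) ρ
      where
      within : Within e
      within k with joins-unique j k
      ... | inj₁ (refl , refl) = u∈
      ... | inj₂ (refl , refl) = closed tt j u∈

    stay-out : ∀ {u v} {Q : E → Set} → u ∉ B → Reach f Q u v → Reach f (λ e → Q e × Without e) u v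
    stay-out u∉ ε = ε
    stay-out {Q = Q} u∉ ((e , Qe , j) ◅ ρ) = (e , (Qe , without) , j) ◅ stay-out (closed∉ j u∉) ρ
      where
      without : Without e
      without k with joins-unique j k
      ... | inj₁ (refl , refl) = u∉
      ... | inj₂ (refl , refl) = closed∉ j u∉

    within : ∀ {u v} → u ∈ B → v ∈ B → Reach f (λ e → ⊤ × Within e) u v
    within u∈ v∈ = stay u∈ (conn₂ u∈ v∈)

    -- The chosen pair cannot be `a`, `b`, because `B` is closed. So it consists of `z` and one of
    -- them, and `z` lies on the same side as its partner.
    crossing-cases : ∀ {e a b} → a ∈ edge e → b ∈ edge e → a ∉ B → b ∈ B →
      ∃ λ z → Tri (edge e) a b z × ((Joins f e a z × z ∉ B) ⊎ (Joins f e b z × z ∈ B))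
    crossing-cases a∈e b∈e a∉ b∈ with pair-cases f a∈e b∈e (∉≢∈ a∉ b∈)
    ... | z , t , inj₁ j        = ⊥-elim (closed∉ j a∉ b∈)
    ... | z , t , inj₂ (inj₁ j) = z , t , inj₁ (j , closed∉ j a∉)
    ... | z , t , inj₂ (inj₂ j) = z , t , inj₂ (j , closed tt j b∈)

  -- Better states from closed sequences of swaps

  module Improvement (cover : Covering) {f : State} (ev : Even f) {r : V} (C : Component f Every r) where
    open Component C
    open Boundary C

    Better : Set
    Better = ∃ λ g → ∃ λ x → Even g × Σ (Component g Every x) λ C′ → ∣ B ∣ < ∣ Component.B C′ ∣

    better : ∀ {a w x} (ss : Swaps f a a) → Distinct ss → (∀ {u} → u ∈ B → Reach (apply ss) Every x u) →
             w ∉ B → Reach (apply ss) Every x w → Better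
    better {x = x} ss d all w∉ xw = apply ss , x , even-apply ss d ev , C′ , larger C C′ all w∉ xw
      where C′ = component (apply ss) every? x

    within-avoiding : ∀ {s x y u v} → Joins f s x y → u ∈ B → v ∈ B → Reach f (λ e → e ≢ s × Within e) u v
    within-avoiding j u∈ v∈ = stay u∈ (avoid ev j (conn₂ u∈ v∈))

    -- The cycle of swaps runs through a, tip and c.  If B loses two edges, then both are at tip.
    triangle : ∀ {a c w e s s′} → a ∉ B → c ∉ B → Tri (edge e) c a w → Joins f e c w ⊎ Joins f e a w →
               w ∉ B → a ∈ edge s → tip ∈ edge s → c ∈ edge s′ → tip ∈ edge s′ → s ≢ s′ → Better
    triangle {a} {c} {w} {e} {s} {s′} a∉ c∉ te dir w∉ a∈s tip∈s c∈s′ tip∈s′ s≢s′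
      with crossing-cases a∈s tip∈s a∉ tip∈ | crossing-cases c∈s′ tip∈s′ c∉ tip∈
    ... | z , t , c₁ | y , t′ , c₂ = go c₁ c₂
      where
      s≢e : s ≢ e
      s≢e = apart te tip∈s (∈≢∉ tip∈ c∉) (∈≢∉ tip∈ a∉) (∈≢∉ tip∈ w∉)
      s′≢e : s′ ≢ e
      s′≢e = apart te tip∈s′ (∈≢∉ tip∈ c∉) (∈≢∉ tip∈ a∉) (∈≢∉ tip∈ w∉)
      distinct : (s ≢ s′ × s ≢ e × ⊤) × (s′ ≢ e × ⊤) × ⊤ × ⊤
      distinct = (s≢s′ , s≢e , tt) , (s′≢e , tt) , tt , tt
      ≢e : ∀ {e′} → Within e′ → e′ ≢ e
      ≢e win = [ (λ j → within-≢ win j c∉) , (λ j → within-≢ win j a∉) ]′ dir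
      go : (Joins f s a z × z ∉ B) ⊎ (Joins f s tip z × z ∈ B) →
           (Joins f s′ c y × y ∉ B) ⊎ (Joins f s′ tip y × y ∈ B) → Better
      go (inj₁ (j , z∉)) (inj₁ (k , y∉)) =
        let ss = mkSwap t (inj₁ j) ◅ mkSwap (flip t′) (inj₂ k) ◅ mkSwap te dir ◅ ε
            j′ , k′ , _ = gains ss distinct
        in better ss distinct
             (λ u∈ → keep ss (λ { (_ , win) → within-≢ win j a∉ , within-≢ win k c∉ , ≢e win , tt }) (within tip∈ u∈))
             z∉ (link tt j′)
      go (inj₁ (j , z∉)) (inj₂ (k , y∈)) =
        let ss = mkSwap t (inj₁ j) ◅ mkSwap (flip t′) (inj₁ k) ◅ mkSwap te dir ◅ ε
            j′ , k′ , _ = gains ss distinct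
        in better ss distinct
             (λ u∈ → keep ss (λ { (≢s′ , win) → within-≢ win j a∉ , ≢s′ , ≢e win , tt }) (within-avoiding k tip∈ u∈))
             z∉ (link tt j′)
      go (inj₂ (j , z∈)) (inj₁ (k , y∉)) =
        let ss = mkSwap t (inj₂ j) ◅ mkSwap (flip t′) (inj₂ k) ◅ mkSwap te dir ◅ ε
            j′ , k′ , _ = gains ss distinct
        in better ss distinct
             (λ u∈ → keep ss (λ { (≢s , win) → ≢s , within-≢ win k c∉ , ≢e win , tt }) (within-avoiding j tip∈ u∈))
             y∉ (link tt k′)
      -- Both triples give up their pairs at `tip`, which may cut `tip` off. The rest of `B` stays
      -- connected and gains `a` through `z` and `c` through `y`.
      go (inj₂ (j , z∈)) (inj₂ (k , y∈)) =
        let ss = mkSwap t (inj₂ j) ◅ mkSwap (flip t′) (inj₁ k) ◅ mkSwap te dir ◅ ε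
            j′ , k′ , _ = gains ss distinct
            C′ = component (apply ss) every? z
            rest : ∀ {u} → u ∈ B → u ≢ tip → Reach (apply ss) Every z u
            rest u∈ u≢ = keep ss
              (λ { ((_ , miss) , win) → misses-≢ miss j , misses-≢ miss k , ≢e win , tt })
              (stay z∈ (noncut z∈ u∈ (joins-≢ j ∘ sym) u≢))
        in apply ss , z , even-apply ss distinct ev , C′ ,
           larger-but C C′ rest (Tri.u≢v te ∘ sym) a∉ c∉
             (link tt (joins-sym j′)) (rest y∈ (joins-≢ k ∘ sym) ◅◅ link tt (joins-sym k′))

    -- All three vertices lie outside `B`, so any two of them can enter `triangle` if their triples
    -- with `tip` differ. If `a` and `q` share theirs, that triple is `a`, `q`, `tip`, and `p` has a
    -- different one.
    no-pure : ∀ {e a p q} → Tri (edge e) a p q → Joins f e a p → a ∉ B → q ∉ B → Better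
    no-pure {e} {a} {p} {q} t j a∉ q∉
      with cover a tip (∉≢∈ a∉ tip∈) | cover q tip (∉≢∈ q∉ tip∈)
    ... | s , a∈s , tip∈s | s′ , q∈s′ , tip∈s′ with s ≟ s′
    ... | no s≢s′ = triangle a∉ q∉ (rotate (rotate t)) (inj₂ j) p∉ a∈s tip∈s q∈s′ tip∈s′ s≢s′
      where p∉ = closed∉ j a∉
    ... | yes refl with cover p tip (∉≢∈ (closed∉ j a∉) tip∈)
    ... | s″ , p∈s″ , tip∈s″ =
      triangle p∉ q∉ (flip (rotate t)) (inj₂ (joins-sym j)) a∉ p∈s″ tip∈s″ q∈s′ tip∈s′ (s″≢s)
      where
      p∉ = closed∉ j a∉
      s″≢s : s″ ≢ s
      s″≢s with pair-cases f a∈s tip∈s (∉≢∈ a∉ tip∈)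
      ... | z , ts , _ with Tri.only ts q∈s′
      ... | inj₁ q≡a           = ⊥-elim (Tri.u≢w t (sym q≡a))
      ... | inj₂ (inj₁ q≡tip)  = ⊥-elim (∉≢∈ q∉ tip∈ q≡tip)
      ... | inj₂ (inj₂ refl)   = apart ts p∈s″ (Tri.u≢v t ∘ sym) (∉≢∈ p∉ tip∈) (Tri.v≢w t)

    sides-≢ : ∀ {e e′ x y u v} → Joins f e x y → x ∉ B → Joins f e′ u v → u ∈ B → e ≢ e′
    sides-≢ j x∉ k u∈ refl with joins-unique j k
    ... | inj₁ (refl , refl) = x∉ u∈
    ... | inj₂ (refl , refl) = closed∉ j x∉ u∈

    -- Once `no-pure` has dealt with triples that avoid `B`, every pair chosen outside `B` belongs
    -- to a triple of this shape.
    record Spoke (a : V) : Set where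
      field
        {hub}  : E
        {foot} : V
        {other} : V
        foot∈  : foot ∈ B
        shape  : Tri (edge hub) a foot other
        pair   : Joins f hub a other

    -- A better state ends the argument wherever it turns up, so `Better` acts as an exception and
    -- the proof runs in the corresponding monad.
    Try : Set → Set
    Try A = Better ⊎ A

    _>>=_ : ∀ {A A′ : Set} → Try A → (A → Try A′) → Try A′
    x >>= k = [ inj₁ , k ]′ x

    fails : ∀ {A : Set} → Better → Try A
    fails = inj₁

    spoke : ∀ {e a a′} → Joins f e a a′ → a ∉ B →
            Try (Σ (Spoke a) λ g → Spoke.hub g ≡ e × Spoke.other g ≡ a′)
    spoke j a∉ with pair-cases f (joins-∈ j) (joins-∈ (joins-sym j)) (joins-≢ j)
    ... | w , t , _ with w ∈? B
    ... | yes w∈ = inj₂ (record { foot∈ = w∈ ; shape = flip (rotate (rotate t)) ; pair = j } , refl , refl)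
    ... | no w∉  = inj₁ (no-pure t j a∉ w∉)

    -- If a triple through `a` and `a′` does not use this pair, its chosen pair leads from one of
    -- them to the third vertex, which is then outside `B`, and `no-pure` applies.
    rim : ∀ {a a′} → a ≢ a′ → a ∉ B → a′ ∉ B → Try (Σ (Spoke a) λ g → Spoke.other g ≡ a′)
    rim a≢a′ a∉ a′∉ with cover _ _ a≢a′
    ... | e , a∈ , a′∈ with pair-cases f a∈ a′∈ a≢a′
    ... | z , t , inj₁ j = do
      g , _ , eq ← spoke j a∉
      inj₂ (g , eq)
    ... | z , t , inj₂ (inj₁ j) = inj₁ (no-pure (flip (rotate (rotate t))) j a∉ a′∉)
    ... | z , t , inj₂ (inj₂ j) = inj₁ (no-pure (flip (rotate (rotate (flip t)))) j a′∉ a∉)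

    module _ {a : V} (a∉ : a ∉ B) where
      open Spoke

      other∉ : (g : Spoke a) → other g ∉ B
      other∉ g = closed∉ (pair g) a∉

      -- The swaps go from `a` to the foot through `hub g` and back through `s`. The first attaches
      -- `other g` to `B`; the second takes at most one edge from `B`, and that is not a bridge.
      double : (g : Spoke a) → ∀ {s} → a ∈ edge s → foot g ∈ edge s → hub g ≢ s → Better
      double g {s} a∈s b∈s g≢s with crossing-cases a∈s b∈s a∉ (foot∈ g)
      ... | y , t , inj₁ (k , y∉) =
        let ss = mkSwap (shape g) (inj₁ (pair g)) ◅ mkSwap (flip t) (inj₂ k) ◅ ε
            d = (g≢s , tt) , tt , tt
            j′ , _ = gains ss d
        in better ss d
             (λ u∈ → keep ss (λ { (_ , win) → within-≢ win (pair g) a∉ , within-≢ win k a∉ , tt })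
               (within (foot∈ g) u∈))
             (other∉ g) (link tt j′)
      ... | y , t , inj₂ (k , y∈) =
        let ss = mkSwap (shape g) (inj₁ (pair g)) ◅ mkSwap (flip t) (inj₁ k) ◅ ε
            d = (g≢s , tt) , tt , tt
            j′ , _ = gains ss d
        in better ss d
             (λ u∈ → keep ss (λ { (≢s , win) → within-≢ win (pair g) a∉ , ≢s , tt })
               (within-avoiding k (foot∈ g) u∈))
             (other∉ g) (link tt j′)

      feet-differ : (g h : Spoke a) → hub g ≢ hub h → Try (foot g ≢ foot h)
      feet-differ g h g≢h with foot g ≟ foot h
      ... | no ≢  = inj₂ ≢
      ... | yes eq = inj₁ (double g (Tri.u∈ (shape h)) (subst (_∈ edge (hub h)) (sym eq) (Tri.v∈ (shape h))) g≢h)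

      module _ (g h : Spoke a) (g≢h : hub g ≢ hub h) {s : E} {z : V} (t : Tri (edge s) (foot g) (foot h) z) where

        g≢s : z ≢ a → hub g ≢ s
        g≢s z≢a = apart t (Tri.u∈ (shape g)) (∉≢∈ a∉ (foot∈ g)) (∉≢∈ a∉ (foot∈ h)) (z≢a ∘ sym)

        h≢s : z ≢ a → hub h ≢ s
        h≢s z≢a = apart t (Tri.u∈ (shape h)) (∉≢∈ a∉ (foot∈ g)) (∉≢∈ a∉ (foot∈ h)) (z≢a ∘ sym)

        -- The swaps run through `a`, `foot g` and `foot h`. `B` loses only the pair of `s`, which
        -- is not a bridge, and gains `other g` at `foot g`.
        bridged : Joins f s (foot g) z ⊎ Joins f s (foot h) z → z ∈ B → Better
        bridged dir z∈ =
          let ss = mkSwap (shape g) (inj₁ (pair g)) ◅ mkSwap t dir ◅ mkSwap (flip (shape h)) (inj₂ (pair h)) ◅ ε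
              z≢a = ∈≢∉ z∈ a∉
              d = (g≢s z≢a , g≢h , tt) , (h≢s z≢a ∘ sym , tt) , tt , tt
              j′ , _ = gains ss d
          in better ss d (λ u∈ → keep ss
                 (λ { (≢s , win) → within-≢ win (pair g) a∉ , ≢s , within-≢ win (pair h) a∉ , tt })
                 ([ (λ k → within-avoiding k (foot∈ g) u∈) , (λ k → within-avoiding k (foot∈ g) u∈) ]′ dir))
               (other∉ g) (link tt j′)

        -- Here the cycle of swaps runs through `a`, one of the two feet and `z`, and is closed by a
        -- triple `e` containing `a` and `z`.
        inner : Joins f s (foot g) (foot h) → z ∈ B → Better
        inner k z∈ with cover a z (∉≢∈ a∉ z∈)
        ... | e , a∈e , z∈e with crossing-cases a∈e z∈e a∉ z∈
        ... | y , te , inj₁ (l , y∉) =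
          let ss = mkSwap (shape g) (inj₁ (pair g)) ◅ mkSwap (flip (rotate (rotate t))) (inj₁ k)
                   ◅ mkSwap (flip te) (inj₂ l) ◅ ε
              z≢a = ∈≢∉ z∈ a∉
              e≢s = apart t a∈e (∉≢∈ a∉ (foot∈ g)) (∉≢∈ a∉ (foot∈ h)) (z≢a ∘ sym)
              e≢g = apart (shape g) z∈e z≢a (Tri.u≢w t ∘ sym) (∈≢∉ z∈ (other∉ g))
              d = (g≢s z≢a , e≢g ∘ sym , tt) , (e≢s ∘ sym , tt) , tt , tt
              j′ , _ = gains ss d
          in better ss d (λ u∈ → keep ss
                 (λ { (≢s , win) → within-≢ win (pair g) a∉ , ≢s , within-≢ win l a∉ , tt })
                 (within-avoiding k (foot∈ g) u∈))
               (other∉ g) (link tt j′)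
        -- Without s and e, the set B falls into at most two parts, around z and around y; the part of
        -- foot g decides which of the two cycles of swaps reconnects them.
        ... | y , te , inj₂ (l , y∈) = [ via-g , via-h ]′ (near (foot∈ g))
          where
          z≢a = ∈≢∉ z∈ a∉
          e≢s = apart t a∈e (∉≢∈ a∉ (foot∈ g)) (∉≢∈ a∉ (foot∈ h)) (z≢a ∘ sym)
          e≢g = apart (shape g) z∈e z≢a (Tri.u≢w t ∘ sym) (∈≢∉ z∈ (other∉ g))
          e≢h = apart (shape h) z∈e z≢a (Tri.v≢w t ∘ sym) (∈≢∉ z∈ (other∉ h))
          near : ∀ {u} → u ∈ B → Reach f (λ x → (x ≢ s × Within x) × x ≢ e) u z ⊎
                                 Reach f (λ x → (x ≢ s × Within x) × x ≢ e) u y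
          near u∈ = split l (within-avoiding k u∈ z∈)
          via-g : Reach f (λ x → (x ≢ s × Within x) × x ≢ e) (foot g) z → Better
          via-g ρ =
            let j₁ , j₂ , j₃ , _ = gains ss d
                out = keep ss (λ { (≢g , wo) → ≢g , without-≢ wo k (foot∈ g) , without-≢ wo l z∈ , tt })
                -- Outside `B`, `other g` remains joined to `a`: `hub g` is not a bridge, and the
                -- other two swapped triples have their pairs inside `B`.
                a′a = out (stay-out (other∉ g) (nonbridge ev (joins-sym (pair g))))
                za′ = reach-sym (back ρ) ◅◅ link tt j₁
                zy = za′ ◅◅ a′a ◅◅ link tt j₃
            in better ss d (λ u∈ → [ reach-sym ∘ back , (λ σ → zy ◅◅ reach-sym (back σ)) ]′ (near u∈)) (other∉ g) za′
            where
            ss = mkSwap (shape g) (inj₁ (pair g)) ◅ mkSwap (flip (rotate (rotate t))) (inj₁ k)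
                 ◅ mkSwap (flip te) (inj₁ l) ◅ ε
            back : ∀ {u v} → Reach f (λ x → (x ≢ s × Within x) × x ≢ e) u v → Reach (apply ss) Every u v
            back = keep ss λ { ((≢s , win) , ≢e) → within-≢ win (pair g) a∉ , ≢s , ≢e , tt }
            d : Distinct ss
            d = (g≢s z≢a , e≢g ∘ sym , tt) , (e≢s ∘ sym , tt) , tt , tt
          via-h : Reach f (λ x → (x ≢ s × Within x) × x ≢ e) (foot g) y → Better
          via-h ρ =
            let j₁ , j₂ , j₃ , _ = gains ss d
                -- After its swap, `s` joins `z` to `foot g`, which lies in the part around `y`.
                zy = link tt j₂ ◅◅ back ρ
            in better ss d (λ u∈ → [ reach-sym ∘ back , (λ σ → zy ◅◅ reach-sym (back σ)) ]′ (near u∈)) a∉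
                 (zy ◅◅ link tt (joins-sym j₃))
            where
            ss = mkSwap (shape h) (inj₁ (pair h)) ◅ mkSwap (rotate t) (inj₁ (joins-sym k))
                 ◅ mkSwap (flip te) (inj₁ l) ◅ ε
            back : ∀ {u v} → Reach f (λ x → (x ≢ s × Within x) × x ≢ e) u v → Reach (apply ss) Every u v
            back = keep ss λ { ((≢s , win) , ≢e) → within-≢ win (pair h) a∉ , ≢s , ≢e , tt }
            d : Distinct ss
            d = (h≢s z≢a , e≢h ∘ sym , tt) , (e≢s ∘ sym , tt) , tt , tt

        -- If `other i` differs from `z`, the swaps run through `a`, `foot g`, `z` and `foot i`,
        -- using `hub g`, `s`, a triple `e` containing `z` and `foot i`, and `hub i`.
        third-spoke : Joins f s (foot g) (foot h) → z ∉ B → z ≢ a → z ≢ other g → (i : Spoke a) → hub i ≢ hub g →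
                      hub i ≢ hub h → Try (other i ≡ z)
        third-spoke k z∉ z≢a z≢a₁ i i≢g i≢h with other i ≟ z
        ... | yes eq = inj₂ eq
        ... | no a₃≢z = do
          b₃≢b₁ ← feet-differ i g i≢g
          b₃≢b₂ ← feet-differ i h i≢h
          n , eq ← rim a₃≢z (other∉ i) z∉
          fails (finish b₃≢b₁ b₃≢b₂ n eq (cover z (foot i) (∉≢∈ z∉ (foot∈ i))))
          where
          finish : foot i ≢ foot g → foot i ≢ foot h → (n : Spoke (other i)) → other n ≡ z →
                   (∃ λ e → z ∈ edge e × foot i ∈ edge e) → Better
          finish b₃≢b₁ b₃≢b₂ n refl (e , z∈e , b₃∈e) with crossing-cases z∈e b₃∈e z∉ (foot∈ i)
          ... | y , te , cs = go cs
            where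
            e≢g : e ≢ hub g
            e≢g = apart (shape g) z∈e z≢a (∉≢∈ z∉ (foot∈ g)) z≢a₁
            e≢i : e ≢ hub i
            e≢i = apart (shape i) z∈e z≢a (∉≢∈ z∉ (foot∈ i)) (a₃≢z ∘ sym)
            e≢s : e ≢ s
            e≢s = apart t b₃∈e b₃≢b₁ b₃≢b₂ (∈≢∉ (foot∈ i) z∉)
            i≢s : hub i ≢ s
            i≢s = apart t (Tri.u∈ (shape i)) (∉≢∈ a∉ (foot∈ g)) (∉≢∈ a∉ (foot∈ h)) (z≢a ∘ sym)
            n≢ : ∀ {x b} → Joins f x a b → hub n ≢ x
            n≢ j refl with joins-unique j (pair n)
            ... | inj₁ (a≡a₃ , _) = joins-≢ (pair i) a≡a₃
            ... | inj₂ (a≡z , _)  = z≢a (sym a≡z)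
            go : (Joins f e z y × y ∉ B) ⊎ (Joins f e (foot i) y × y ∈ B) → Better
            go (inj₁ (l , y∉)) =
              let ss = mkSwap (shape g) (inj₁ (pair g)) ◅ mkSwap (flip (rotate (rotate t))) (inj₁ k)
                       ◅ mkSwap te (inj₁ l) ◅ mkSwap (flip (shape i)) (inj₂ (pair i)) ◅ ε
                  d = (g≢s z≢a , e≢g ∘ sym , i≢g ∘ sym , tt) , (e≢s ∘ sym , i≢s ∘ sym , tt) , (e≢i , tt) , tt , tt
                  j₁ , _ = gains ss d
              in better ss d (λ u∈ → keep ss
                     (λ { (≢s , win) → within-≢ win (pair g) a∉ , ≢s , within-≢ win l z∉ ,
                                       within-≢ win (pair i) a∉ , tt })
                     (within-avoiding k (foot∈ g) u∈))
                   (other∉ g) (link tt j₁)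
            -- `B` loses the pairs of `s` and `e`, but both ends of the latter are joined to `z`
            -- afterwards: `y` by `e` itself, and `foot i` through `other i` by the spoke `n` and
            -- `hub i`.
            go (inj₂ (l , y∈)) =
              let ss = mkSwap (shape g) (inj₁ (pair g)) ◅ mkSwap (flip (rotate (rotate t))) (inj₁ k)
                       ◅ mkSwap te (inj₂ l) ◅ mkSwap (flip (shape i)) (inj₂ (pair i)) ◅ ε
                  d = (g≢s z≢a , e≢g ∘ sym , i≢g ∘ sym , tt) , (e≢s ∘ sym , i≢s ∘ sym , tt) , (e≢i , tt) , tt , tt
                  j₁ , j₂ , j₃ , j₄ , _ = gains ss d
                  zb₃ = link tt (joins-cong (apply-avoids ss
                          (n≢ (pair g) , sides-≢ (pair n) (other∉ i) k (foot∈ g) ,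
                           sides-≢ (pair n) (other∉ i) l (foot∈ i) , n≢ (pair i) , tt)) (joins-sym (pair n)))
                        ◅◅ link tt (joins-sym j₄)
                  back : ∀ {u v} → Reach f (λ x → (x ≢ s × Within x) × x ≢ e) u v → Reach (apply ss) Every u v
                  back = keep ss λ { ((≢s , win) , ≢e) → within-≢ win (pair g) a∉ , ≢s , ≢e ,
                                                         within-≢ win (pair i) a∉ , tt }
              in better ss d (λ u∈ →
                    [ (λ σ → zb₃ ◅◅ reach-sym (back σ)) , (λ σ → link tt j₃ ◅◅ reach-sym (back σ)) ]′
                      (split l (within-avoiding k u∈ (foot∈ i))))
                   z∉ ε

    reversed : ∀ {a} (g : Spoke a) → Spoke (Spoke.other g)
    reversed g = record
      { foot∈ = Spoke.foot∈ g ; shape = flip (rotate (Spoke.shape g)) ; pair = joins-sym (Spoke.pair g) }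

    module _ {a : V} (a∉ : a ∉ B) where
      open Spoke

      -- `z` completes the two feet to a triple. If this triple chooses a pair with `z`, or `z` is
      -- in `B`, then `bridged` or `inner` applies; if `z` is `a` or one of the other ends, it
      -- shares two triples with a foot, as `double` requires.
      apex : (g h : Spoke a) → hub g ≢ hub h →
             Try (∃ λ z → z ∉ B × z ≢ a × z ≢ other g × z ≢ other h ×
                  ((i : Spoke a) → hub i ≢ hub g → hub i ≢ hub h → Try (other i ≡ z)))
      apex g h g≢h = do
        b₁≢b₂ ← feet-differ a∉ g h g≢h
        let s , b₁∈s , b₂∈s = cover (foot g) (foot h) b₁≢b₂
        chosen (pair-cases f b₁∈s b₂∈s b₁≢b₂)
        where
        chosen : ∀ {s} → (∃ λ z → Tri (edge s) (foot g) (foot h) z ×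
                   (Joins f s (foot g) (foot h) ⊎ Joins f s (foot g) z ⊎ Joins f s (foot h) z)) → _
        chosen (z , t , inj₂ (inj₁ j)) = fails (bridged a∉ g h g≢h t (inj₁ j) (closed tt j (foot∈ g)))
        chosen (z , t , inj₂ (inj₂ j)) = fails (bridged a∉ g h g≢h t (inj₂ j) (closed tt j (foot∈ h)))
        chosen (z , t , inj₁ j) with z ∈? B | z ≟ a | z ≟ other g | z ≟ other h
        ... | yes z∈ | _        | _        | _        = fails (inner a∉ g h g≢h t j z∈)
        ... | no _   | yes refl | _        | _        =
          fails (double a∉ g (Tri.w∈ t) (Tri.u∈ t) (sides-≢ (pair g) a∉ j (foot∈ g)))
        ... | no z∉  | no z≢a   | yes refl | _        =
          fails (double z∉ (reversed g) (Tri.w∈ t) (Tri.u∈ t) (sides-≢ (pair g) a∉ j (foot∈ g)))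
        ... | no z∉  | no z≢a   | no z≢a₁  | yes refl =
          fails (double z∉ (reversed h) (Tri.w∈ t) (Tri.v∈ t) (sides-≢ (pair h) a∉ j (foot∈ g)))
        ... | no z∉  | no z≢a   | no z≢a₁  | no z≢a₂  =
          inj₂ (z , z∉ , z≢a , z≢a₁ , z≢a₂ , third-spoke a∉ g h g≢h t j z∉ z≢a z≢a₁)

      -- As `hub g` is not a bridge, some path from `a` to `other g` avoids it, and its first edge
      -- gives the new spoke.
      second : (g : Spoke a) → Try (Σ (Spoke a) λ h → hub h ≢ hub g)
      second g with nonbridge ev (pair g)
      ... | ρ = first (joins-≢ (pair g)) ρ
        where
        first : ∀ {y} → a ≢ y → Reach f (_≢ hub g) a y → Try (Σ (Spoke a) λ h → hub h ≢ hub g)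
        first a≢y ε = ⊥-elim (a≢y refl)
        first _ ((e , e≢g , j) ◅ _) = do
          h , eq , _ ← spoke j a∉
          inj₂ (h , subst (_≢ hub g) (sym eq) e≢g)

      -- The degree of `a` is even, so three edges at `a` entail a further one.
      fourth : (g h i : Spoke a) → hub g ≢ hub h → hub g ≢ hub i → hub h ≢ hub i →
               Try (Σ (Spoke a) λ l → hub l ≢ hub g × hub l ≢ hub h × hub l ≢ hub i)
      fourth g h i g≢h g≢i h≢i
        with odd-rest (crossing f (δ a)) ((g≢h ∷ g≢i ∷ []) ∷ (h≢i ∷ []) ∷ [] ∷ [])
               (cong₂ _xor_ (ev (δ a)) (cong₂ _xor_ (one g) (cong₂ _xor_ (one h) (cong (_xor false) (one i)))))
        where
        one : (k : Spoke a) → crossing f (δ a) (hub k) ≡ true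
        one k = trans (joins-crossing (δ a) (pair k))
          (cong₂ _xor_ (dec-true (a ≟ a) refl) (dec-false (other k ≟ a) (joins-≢ (pair k) ∘ sym)))
      ... | e , (e≢g ∷ e≢h ∷ e≢i ∷ []) , te = do
        l , eq , _ ← spoke (proj₂ (crossing-joins f te)) a∉
        inj₂ (l , subst (_≢ hub g) (sym eq) e≢g , subst (_≢ hub h) (sym eq) e≢h , subst (_≢ hub i) (sym eq) e≢i)

      -- The apex of g, h forces other i = other l, whereas the apex of g, i differs from other i and
      -- equals other l.
      contradict : Spoke a → Better
      contradict g = [ id , ⊥-elim ]′ (do
        h , h≢g ← second g
        z , z∉ , z≢a , z≢g , z≢h , also ← apex g h (h≢g ∘ sym)
        i , i≡z ← rim (z≢a ∘ sym) a∉ z∉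
        let i≢g : hub i ≢ hub g
            i≢g eq = z≢g (trans (sym i≡z) (same-other i g eq))
            i≢h : hub i ≢ hub h
            i≢h eq = z≢h (trans (sym i≡z) (same-other i h eq))
        l , l≢g , l≢h , l≢i ← fourth g h i (h≢g ∘ sym) (i≢g ∘ sym) (i≢h ∘ sym)
        l≡z ← also l l≢g l≢h
        y , _ , _ , _ , y≢i , also′ ← apex g i (i≢g ∘ sym)
        l≡y ← also′ l l≢g l≢i
        inj₂ (y≢i (trans (trans (sym l≡y) l≡z) (sym i≡z))))
        where
        same-other : (i g : Spoke a) → hub i ≡ hub g → other i ≡ other g
        same-other i g eq with joins-unique (pair i) (subst (λ e → Joins f e a (other g)) (sym eq) (pair g))
        ... | inj₁ (_ , eq′) = eq′
        ... | inj₂ (a≡ , _)  = ⊥-elim (joins-≢ (pair g) a≡)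

    improve : Try (∀ e → p (f e) ∈ B)
    improve with any? (λ e → ¬? (p (f e) ∈? B))
    ... | no none = inj₂ λ e → decidable-stable (p (f e) ∈? B) λ p∉ → none (e , p∉)
    ... | yes (e , p∉) = do
      g , _ ← spoke (joins fwd) p∉
      fails (contradict p∉ g)

  Connected : State → Set
  Connected f = ∀ e e′ → Reach f Every (p (f e)) (p (f e′))

  -- Each better state has a larger component, of at most `n` vertices; `k` bounds the number of
  -- remaining improvements.
  connect : Covering → ∀ k {f} → Even f → ∀ {r} (C : Component f Every r) → n ≤ k + ∣ Component.B C ∣ →
            ∃ λ g → Even g × Connected g
  connect cover k ev C bound with Improvement.improve cover ev C
  ... | inj₂ all = _ , ev , λ e e′ → Component.conn₂ C (all e) (all e′)
  connect cover zero ev C bound | inj₁ (g , x , ev′ , C′ , lt) =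
    ⊥-elim (<⇒≱ lt (≤-trans (∣p∣≤n (Component.B C′)) bound))
  connect cover (suc k) ev C bound | inj₁ (g , x , ev′ , C′ , lt) =
    connect cover k ev′ C′ (≤-trans bound
      (subst (_≤ k + ∣ Component.B C′ ∣) (+-suc k ∣ Component.B C ∣) (+-monoʳ-≤ k lt)))

  connected-state : Covering → E → ∃ Even → ∃ λ f → Even f × Connected f
  connected-state cover e (f , even) = connect cover n even (component f every? (p (f e))) (m≤m+n n _)

  -- Existence of even states

  joins-tri : ∀ {f e u v} → Joins f e u v → Tri (edge e) u v (w (f e))
  joins-tri {f} {e} (joins fwd) = tri (f e)
  joins-tri {f} {e} (joins bwd) = flip (tri (f e))

  δ-self : ∀ a → δ a a ≡ true
  δ-self a = dec-true (a ≟ a) refl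

  δ-other : ∀ {a x} → x ≢ a → δ a x ≡ false
  δ-other {a} {x} = dec-false (x ≟ a)

  expand : ∀ (S : V → Bool) x → S x ≡ sum λ v → S v ∧ δ v x
  expand S x = sym (trans
    (sum-single x {λ v → S v ∧ δ v x} λ v v≢x → trans (cong (S v ∧_) (δ-other (v≢x ∘ sym))) (∧-zeroʳ (S v)))
    (trans (cong (S x ∧_) (δ-self x)) (∧-identityʳ (S x))))

  -- By linearity: `S` is the sum of the indicators `δ v` of its members, so its cut is the sum of
  -- their degrees modulo 2.
  cut-expand : ∀ f S → cut f S ≡ sum λ v → sum λ e → S v ∧ crossing f (δ v) e
  cut-expand f S = trans (sum-cong-≗ λ e → begin
      crossing f S e
        ≡⟨ cong₂ _xor_ (expand S (p (f e))) (expand S (q (f e))) ⟩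
      (sum λ v → S v ∧ δ v (p (f e))) xor (sum λ v → S v ∧ δ v (q (f e)))
        ≡⟨ ∑-distrib-+ (λ v → S v ∧ δ v (p (f e))) (λ v → S v ∧ δ v (q (f e))) ⟨
      (sum λ v → (S v ∧ δ v (p (f e))) xor (S v ∧ δ v (q (f e))))
        ≡⟨ sum-cong-≗ (λ v → sym (∧-distribˡ-xor (S v) (δ v (p (f e))) (δ v (q (f e))))) ⟩
      (sum λ v → S v ∧ crossing f (δ v) e) ∎)
    (∑-comm λ e v → S v ∧ crossing f (δ v) e)
    where open ≡-Reasoning

  -- The degree of `r` is even by the handshake argument: all degrees add up to the cut of the whole
  -- vertex set, which no pair crosses.
  degrees-even : ∀ {f} r → (∀ v → v ≢ r → cut f (δ v) ≡ false) → Even f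
  degrees-even {f} r even S = trans (cut-expand f S)
    (sum-false {n} {λ v → sum λ e → S v ∧ crossing f (δ v) e} λ v → scale v (S v))
    where
    all-even : ∀ v → cut f (δ v) ≡ false
    all-even v with v ≟ r
    ... | no v≢r   = even v v≢r
    ... | yes refl = begin
      cut f (δ r)
        ≡⟨ sum-single r {λ v → cut f (δ v)} even ⟨
      (sum λ v → cut f (δ v))
        ≡⟨ cut-expand f (λ _ → true) ⟨
      cut f (λ _ → true)
        ≡⟨ sum-false {m} {crossing f (λ _ → true)} (λ _ → refl) ⟩
      false ∎
      where open ≡-Reasoning
    scale : ∀ v b → (sum λ e → b ∧ crossing f (δ v) e) ≡ false
    scale v false = sum-false {m} {λ _ → false} λ _ → refl
    scale v true  = all-even v

  -- When a state τ is read as a choice of toggles, the pair of a triple is the pair of vertices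
  -- whose parities it can flip; every compatible g uses the third vertex, together with one of them.
  module Toggling (τ : State) {P : E → Set} where

    Compatible : State → Set
    Compatible g = ∀ {e} → P e → ∃ λ x → Joins g e (w (τ e)) x

    -- A compatible state pairs the third vertex of `e` with `u` or with `v`. Passing from one to
    -- the other is a swap along `u`, `v`, and keeps the state compatible.
    toggle₁ : ∀ {g u v} → Compatible g → Link τ P u v →
              ∃ λ g′ → Compatible g′ × ∀ S → cut g′ S ≡ cut g S xor (S u xor S v)
    toggle₁ {g} {u} {v} comp (e , Pe , j) = apply ss , comp′ , cut-apply ss (tt , tt)
      where
      t : Tri (edge e) u v (w (τ e))
      t = joins-tri j
      side : Joins g e u (w (τ e)) ⊎ Joins g e v (w (τ e))
      side with comp Pe
      ... | x , k with Tri.only t (joins-∈ (joins-sym k))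
      ... | inj₁ refl        = inj₁ (joins-sym k)
      ... | inj₂ (inj₁ refl) = inj₂ (joins-sym k)
      ... | inj₂ (inj₂ refl) = ⊥-elim (joins-≢ k refl)
      ss : Swaps g u v
      ss = mkSwap t side ◅ ε
      comp′ : Compatible (apply ss)
      comp′ {e′} Pe′ = go (e′ ≟ e)
        where
        go : Dec (e′ ≡ e) → ∃ λ x → Joins (apply ss) e′ (w (τ e′)) x
        go (yes refl) = _ , joins-sym (proj₁ (gains ss (tt , tt)))
        go (no e′≢e)  = _ , joins-cong (apply-avoids ss (e′≢e , tt)) (proj₂ (comp Pe′))

    toggle : ∀ {g u v} → Compatible g → Reach τ P u v →
             ∃ λ g′ → Compatible g′ × ∀ S → cut g′ S ≡ cut g S xor (S u xor S v)
    toggle {g} {u} comp ε = g , comp , λ S → xor-cancel (cut g S) (S u)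
    toggle {g} {u} {v} comp (_◅_ {j = x} l ρ) =
      let g₁ , comp₁ , eq₁ = toggle₁ {g} comp l
          g₂ , comp₂ , eq₂ = toggle {g₁} comp₁ ρ
      in g₂ , comp₂ , λ S → trans (eq₂ S) (trans (cong (_xor (S x xor S v)) (eq₁ S))
           (xor-telescope (cut g S) (S u) (S x) (S v)))

    Balanced : V → State → V → Set
    Balanced r g v = v ≢ r → cut g (δ v) ≡ false

    -- An odd vertex `v` other than `r` is corrected by toggling along a path from `v` to `r`, which
    -- alters only the parities of these two.
    balance : ∀ {g} r → Compatible g → (∀ v → Reach τ P v r ⊎ cut g (δ v) ≡ false) → ∀ vs →
              ∃ λ g′ → Compatible g′ × All (Balanced r g′) vs × (∀ v → Balanced r g v → Balanced r g′ v)
    balance {g} r comp able [] = g , comp , [] , λ _ → id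
    balance {g} r comp able (v ∷ vs) with balance {g} r comp able vs
    ... | g₁ , comp₁ , done₁ , kept₁ with v ≟ r | cut g₁ (δ v) in eq
    ... | yes v≡r | _     = g₁ , comp₁ , (λ v≢r → ⊥-elim (v≢r v≡r)) ∷ done₁ , kept₁
    ... | no _    | false = g₁ , comp₁ , (λ _ → eq) ∷ done₁ , kept₁
    ... | no v≢r  | true with able v
    ...   | inj₂ even with trans (sym eq) (kept₁ v (λ _ → even) v≢r)
    ...     | ()
    balance {g} r comp able (v ∷ vs) | g₁ , comp₁ , done₁ , kept₁ | no v≢r | true | inj₁ ρ
      with toggle comp₁ ρ
    ... | g₂ , comp₂ , eq₂ = g₂ , comp₂ , fixed ∷ All.map (λ {x} → keeps x) done₁ , λ x → keeps x ∘ kept₁ x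
      where
      fixed : Balanced r g₂ v
      fixed _ = trans (eq₂ (δ v)) (cong₂ _xor_ eq (cong₂ _xor_ (δ-self v) (δ-other (v≢r ∘ sym))))
      keeps : ∀ x → Balanced r g₁ x → Balanced r g₂ x
      keeps x even x≢r with x ≟ v
      ... | yes refl = fixed x≢r
      ... | no x≢v   = trans (eq₂ (δ x))
        (cong₂ _xor_ (even x≢r) (cong₂ _xor_ (δ-other (x≢v ∘ sym)) (δ-other (x≢r ∘ sym))))

    even-state : ∀ {g} r → Compatible g → (∀ v → Reach τ P v r ⊎ cut g (δ v) ≡ false) → ∃ Even
    even-state {g} r comp able with balance {g} r comp able (allFin n)
    ... | g′ , _ , done , _ = g′ , degrees-even {g′} r λ v → All.lookup done (∈-allFin v)

  toggled : State → State
  toggled τ e = order (flip (rotate (rotate (tri (τ e)))))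

  joins-toggled : ∀ τ {e} → Joins (toggled τ) e (w (τ e)) (p (τ e))
  joins-toggled τ = joins bwd

  spanning : ∀ (τ : State) r → (∀ v → Reach τ Every v r) → ∃ Even
  spanning τ r reach = Toggling.even-state τ {Every} {toggled τ} r (λ _ → _ , joins-toggled τ) (inj₁ ∘ reach)

  -- If a is the only vertex whose parity cannot be toggled, then it is corrected by the triple e₀.
  spanning-but : ∀ (τ : State) {a e₀} z → w (τ e₀) ≡ a → (∀ v → v ≢ a → Reach τ (_≢ e₀) v z) → ∃ Even
  spanning-but τ {a} {e₀} z w≡a reach with cut (toggled τ) (δ a) in eq
  ... | false = Toggling.even-state τ {Every} {toggled τ} z (λ _ → _ , joins-toggled τ) able
    where
    able : ∀ v → Reach τ Every v z ⊎ cut (toggled τ) (δ v) ≡ false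
    able v with v ≟ a
    ... | yes refl = inj₂ eq
    ... | no v≢a   = inj₁ (reach-map (λ _ → link tt) (reach v v≢a))
  -- At `e₀`, the pair `p`, `q` replaces the pair `p`, `w`. This removes one edge at `a`, and only
  -- the other triples are toggled from then on.
  ... | true = Toggling.even-state τ {_≢ e₀} {upd (toggled τ) e₀ (τ e₀)} z
      (λ e≢ → _ , joins-cong (upd-other (toggled τ) (τ e₀) e≢) (joins-toggled τ)) able
    where
    able : ∀ v → Reach τ (_≢ e₀) v z ⊎ cut (upd (toggled τ) e₀ (τ e₀)) (δ v) ≡ false
    able v with v ≟ a
    ... | no v≢a   = inj₁ (reach v v≢a)
    ... | yes refl = inj₂ (trans (cut-upd (toggled τ) e₀ (τ e₀) (δ a)) (cong₂ _xor_ eq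
      (cong₂ _xor_ (cong₂ _xor_ p≢ w≡) (cong₂ _xor_ p≢
        (δ-other λ q≡a → Tri.v≢w (tri (τ e₀)) (trans q≡a (sym w≡a)))))))
      where
      p≢ : δ a (p (τ e₀)) ≡ false
      p≢ = δ-other λ p≡a → Tri.u≢w (tri (τ e₀)) (trans p≡a (sym w≡a))
      w≡ : δ a (w (τ e₀)) ≡ true
      w≡ = trans (cong (δ a) w≡a) (δ-self a)

  keep-upd : ∀ {f s u v} {P Q : E → Set} o → (∀ {e} → Q e → e ≢ s × P e) →
             Reach f Q u v → Reach (upd f s o) P u v
  keep-upd {f} o h = reach-map λ Qe j → link (proj₂ (h Qe)) (joins-cong (upd-other f o (proj₁ (h Qe))) j)

  -- Enlarging a component of the toggle graph

  module Existence (cover : Covering) (another : ∀ (e : E) → ∃ (_≢ e)) where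

    module Step {τ : State} {r : V} (C : Component τ Every r) where
      open Component C
      open Boundary C

      Larger : Set
      Larger = ∃ λ τ′ → ∃ λ x → Σ (Component τ′ Every x) λ C′ → ∣ B ∣ < ∣ Component.B C′ ∣

      larger-at : ∀ {τ′ x a} → (∀ {u} → u ∈ B → Reach τ′ Every x u) → a ∉ B → Reach τ′ Every x a → Larger
      larger-at {τ′} {x} all a∉ ρ = τ′ , x , component τ′ every? x , larger C (component τ′ every? x) all a∉ ρ

      -- The pair of `s` lies outside `B`, so redirecting it to `tip`, `a` costs `B` nothing.
      attach : ∀ {s a z} → Tri (edge s) a tip z → Joins τ s a z → a ∉ B → Larger
      attach t j a∉ = larger-at
        (λ u∈ → keep-upd (order (flip t)) (λ { (_ , win) → within-≢ win j a∉ , tt }) (within tip∈ u∈))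
        a∉ (link tt (upd-joins τ (flip t)))

      -- If both triples choose pairs at `tip` inside `B`, then `s` is redirected from `tip`, `z` to
      -- `z`, `a`. Only `tip` could be cut off by this, and `s′` keeps it attached.
      two-outside : ∀ {a a′} → a ∉ B → a′ ∉ B → a ≢ a′ → Larger
      two-outside {a} {a′} a∉ a′∉ a≢a′ with cover a tip (∉≢∈ a∉ tip∈) | cover a′ tip (∉≢∈ a′∉ tip∈)
      ... | s , a∈s , tip∈s | s′ , a′∈s′ , tip∈s′
        with crossing-cases a∈s tip∈s a∉ tip∈ | crossing-cases a′∈s′ tip∈s′ a′∉ tip∈
      ... | _ , t , inj₁ (j , _) | _ = attach t j a∉
      ... | _ | _ , t , inj₁ (j , _) = attach t j a′∉
      ... | z , t , inj₂ (j , z∈) | z′ , t′ , inj₂ (j′ , z′∈) = larger-at all a∉ (link tt (upd-joins τ t₂))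
        where
        t₂ : Tri (edge s) z a tip
        t₂ = rotate (rotate t)
        s′≢s : s′ ≢ s
        s′≢s = apart t a′∈s′ (a≢a′ ∘ sym) (∉≢∈ a′∉ tip∈) (∉≢∈ a′∉ z∈)
        rest : ∀ {u} → u ∈ B → u ≢ tip → Reach (upd τ s (order t₂)) Every z u
        rest u∈ u≢ = keep-upd (order t₂) (λ { (_ , miss) → misses-≢ miss j , tt })
          (noncut z∈ u∈ (joins-≢ j ∘ sym) u≢)
        all : ∀ {u} → u ∈ B → Reach (upd τ s (order t₂)) Every z u
        all {u} u∈ with u ≟ tip
        ... | no u≢    = rest u∈ u≢
        ... | yes refl = rest z′∈ (joins-≢ j′ ∘ sym) ◅◅
          link tt (joins-cong (upd-other τ (order t₂) s′≢s) (joins-sym j′))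

      -- The triple e₀ = tip z a is to be spared.  If tip depends on it, then the last vertex b reached
      -- from z without e₀ has two other edges, one of which can be redirected to tip.
      one-outside : ∀ {a} → a ∉ B → (∀ v → v ≢ a → v ∈ B) → ∃ Even
      one-outside {a} a∉ others with cover a tip (∉≢∈ a∉ tip∈)
      ... | e₀ , a∈e₀ , tip∈e₀ with crossing-cases a∈e₀ tip∈e₀ a∉ tip∈
      ... | z , t₀ , inj₁ (j₀ , z∉) = ⊥-elim (z∉ (others z (joins-≢ j₀ ∘ sym)))
      ... | z , t₀ , inj₂ (j₀ , z∈) = go (tip ∈? K)
        where
        isolated : ∀ {e y} → ¬ Joins τ e a y
        isolated j = a∉ (closed tt (joins-sym j) (others _ (joins-≢ j ∘ sym)))
        omits : ∀ {e} → a ∈ edge e → w (τ e) ≡ a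
        omits {e} a∈e with Tri.only (tri (τ e)) a∈e
        ... | inj₁ refl        = ⊥-elim (isolated (joins fwd))
        ... | inj₂ (inj₁ refl) = ⊥-elim (isolated (joins bwd))
        ... | inj₂ (inj₂ refl) = refl
        D : Component τ (_≢ e₀) z
        D = component τ (λ e → ¬? (e ≟ e₀)) z
        module D = Component D
        K : Subset n
        K = D.B
        b : V
        b = D.tip
        to-z : ∀ v → v ≢ a → v ≢ tip → Reach τ (_≢ e₀) v z
        to-z v v≢a v≢tip = reach-map (λ { (_ , miss) j → link (misses-≢ miss j₀) j })
          (noncut (others v v≢a) z∈ v≢tip (joins-≢ j₀ ∘ sym))
        in-K : ∀ v → v ≢ a → v ≢ tip → v ∈ K
        in-K v v≢a v≢tip = reach-closed D D.root (reach-sym (to-z v v≢a v≢tip))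
        stuck : ∀ {v} {P : E → Set} → Reach τ P a v → a ≡ v
        stuck ε                 = refl
        stuck ((_ , _ , j) ◅ _) = ⊥-elim (isolated j)
        a∉K : a ∉ K
        a∉K a∈K = ∉≢∈ a∉ z∈ (stuck (reach-sym (D.conn a∈K)))
        go : Dec (tip ∈ K) → ∃ Even
        go (yes tip∈K) = spanning-but τ z (omits a∈e₀) reach
          where
          reach : ∀ v → v ≢ a → Reach τ (_≢ e₀) v z
          reach v v≢a with v ≟ tip
          ... | yes refl = reach-sym (D.conn tip∈K)
          ... | no v≢tip = to-z v v≢a v≢tip
        go (no tip∉K) with b ≟ z
        -- Now `K` is just `z`, so all vertices are `a`, `tip` and `z`. The pair of a second edge
        -- would also be `tip`, `z`, which would put `tip` into `K`.
        ... | yes b≡z with another e₀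
        ...   | e , e≢e₀ = ⊥-elim (both
          (is (p (τ e)) λ p≡a → isolated {e} (subst (λ x → Joins τ e x (q (τ e))) p≡a (joins fwd)))
          (is (q (τ e)) λ q≡a → isolated {e} (subst (λ x → Joins τ e x (p (τ e))) q≡a (joins bwd))))
          where
          is : ∀ v → v ≢ a → v ≡ tip ⊎ v ≡ z
          is v v≢a with v ≟ tip
          ... | yes v≡tip = inj₁ v≡tip
          ... | no v≢tip  = inj₂ (D.alone b≡z (in-K v v≢a v≢tip))
          both : p (τ e) ≡ tip ⊎ p (τ e) ≡ z → q (τ e) ≡ tip ⊎ q (τ e) ≡ z → ⊥
          both (inj₁ p≡) (inj₁ q≡) = Tri.u≢v (tri (τ e)) (trans p≡ (sym q≡))
          both (inj₂ p≡) (inj₂ q≡) = Tri.u≢v (tri (τ e)) (trans p≡ (sym q≡))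
          both (inj₁ p≡) (inj₂ q≡) =
            tip∉K (subst (_∈ K) p≡ (D.closed e≢e₀ (joins bwd) (subst (_∈ K) (sym q≡) D.root)))
          both (inj₂ p≡) (inj₁ q≡) =
            tip∉K (subst (_∈ K) q≡ (D.closed e≢e₀ (joins fwd) (subst (_∈ K) (sym p≡) D.root)))
        go (no tip∉K) | no b≢z =
          redirect (pair-cases τ b∈s tip∈s b≢tip) (pair-cases τ b∈s′ a∈s′ b≢a)
          where
          b≢tip : b ≢ tip
          b≢tip b≡tip = tip∉K (subst (_∈ K) b≡tip D.tip∈)
          b≢a : b ≢ a
          b≢a b≡a = a∉K (subst (_∈ K) b≡a D.tip∈)
          s s′ : E
          s = proj₁ (cover b tip b≢tip)
          s′ = proj₁ (cover b a b≢a)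
          b∈s : b ∈ edge s
          b∈s = proj₁ (proj₂ (cover b tip b≢tip))
          tip∈s : tip ∈ edge s
          tip∈s = proj₂ (proj₂ (cover b tip b≢tip))
          b∈s′ : b ∈ edge s′
          b∈s′ = proj₁ (proj₂ (cover b a b≢a))
          a∈s′ : a ∈ edge s′
          a∈s′ = proj₂ (proj₂ (cover b a b≢a))
          s≢e₀ : s ≢ e₀
          s≢e₀ = apart t₀ b∈s b≢a b≢tip b≢z
          s′≢e₀ : s′ ≢ e₀
          s′≢e₀ = apart t₀ b∈s′ b≢a b≢tip b≢z
          redirect : (∃ λ y → Tri (edge s) b tip y × (Joins τ s b tip ⊎ Joins τ s b y ⊎ Joins τ s tip y)) →
                     (∃ λ x → Tri (edge s′) b a x × (Joins τ s′ b a ⊎ Joins τ s′ b x ⊎ Joins τ s′ a x)) → ∃ Even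
          redirect (_ , _ , inj₁ j) _ = ⊥-elim (tip∉K (D.closed s≢e₀ j D.tip∈))
          redirect (y , t , inj₂ (inj₂ j)) _ = ⊥-elim (tip∉K (D.closed s≢e₀ (joins-sym j)
            (in-K y (λ { refl → isolated (joins-sym j) }) (joins-≢ j ∘ sym))))
          redirect _ (_ , _ , inj₁ j)        = ⊥-elim (isolated (joins-sym j))
          redirect _ (_ , _ , inj₂ (inj₂ j)) = ⊥-elim (isolated j)
          -- `s` now serves `tip`, while `s′` keeps `b` attached. The rest of `K` stays connected
          -- without `b`, the vertex reached last.
          redirect (y , t , inj₂ (inj₁ j)) (x , t′ , inj₂ (inj₁ j′)) =
            spanning-but τ′ y (trans (cong w (upd-other τ (order t₂) (s≢e₀ ∘ sym))) (omits a∈e₀)) reach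
            where
            t₂ : Tri (edge s) tip y b
            t₂ = rotate t
            τ′ : State
            τ′ = upd τ s (order t₂)
            s′≢s : s′ ≢ s
            s′≢s = apart t a∈s′ (b≢a ∘ sym) (∉≢∈ a∉ tip∈) λ { refl → isolated (joins-sym j) }
            rest : ∀ {v} → v ∈ K → v ≢ b → Reach τ′ (_≢ e₀) v y
            rest v∈ v≢b = keep-upd (order t₂) (λ { (e≢ , miss) → misses-≢ miss j , e≢ })
              (D.noncut v∈ (D.closed s≢e₀ j D.tip∈) v≢b (joins-≢ j ∘ sym))
            reach : ∀ v → v ≢ a → Reach τ′ (_≢ e₀) v y
            reach v v≢a with v ≟ tip | v ≟ b
            ... | yes refl | _        = link s≢e₀ (upd-joins τ t₂)
            ... | no _     | yes refl = link s′≢e₀ (joins-cong (upd-other τ (order t₂) s′≢s) j′)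
              ◅◅ rest (D.closed s′≢e₀ j′ D.tip∈) (joins-≢ j′ ∘ sym)
            ... | no v≢tip | no v≢b   = rest (in-K v v≢a v≢tip) v≢b

      step : Larger ⊎ ∃ Even
      step with any? (λ a → ¬? (a ∈? B))
      ... | no none = inj₂ (spanning τ r λ v → reach-sym (conn (decidable-stable (v ∈? B) λ v∉ → none (v , v∉))))
      ... | yes (a , a∉) with any? (λ a′ → ¬? (a′ ∈? B) ×-dec ¬? (a ≟ a′))
      ...   | yes (a′ , a′∉ , a≢a′) = inj₁ (two-outside a∉ a′∉ a≢a′)
      ...   | no none = inj₂ (one-outside a∉ λ v v≢a → decidable-stable (v ∈? B) λ v∉ → none (v , v∉ , v≢a ∘ sym))

    search : ∀ k {τ r} (C : Component τ Every r) → n ≤ k + ∣ Component.B C ∣ → ∃ Even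
    search k C bound with Step.step C
    ... | inj₂ even = even
    search zero C bound | inj₁ (τ′ , x , C′ , lt) = ⊥-elim (<⇒≱ lt (≤-trans (∣p∣≤n (Component.B C′)) bound))
    search (suc k) C bound | inj₁ (τ′ , x , C′ , lt) =
      search k C′ (≤-trans bound (subst (_≤ k + ∣ Component.B C′ ∣) (+-suc k ∣ Component.B C ∣) (+-monoʳ-≤ k lt)))

    even-exists : State → E → ∃ Even
    even-exists τ e = search n (component τ every? (p (τ e))) (m≤m+n n _)

  -- Euler trails

  open import Data.List.Relation.Binary.Permutation.Setoid.Properties (setoid E) using (Unique-resp-↭; ++-comm)

  _∈ₗ?_ : ∀ e es → Dec (e ∈ₗ es)
  _∈ₗ?_ = mem? (_≟_ {m})

  data Trail (f : State) : V → V → List E → Set where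
    []  : ∀ {u} → Trail f u u []
    _∷_ : ∀ {u v w e es} → Joins f e u v → Trail f v w es → Trail f u w (e ∷ es)

  _++ₜ_ : ∀ {f u v w es fs} → Trail f u v es → Trail f v w fs → Trail f u w (es ++ fs)
  []      ++ₜ t′ = t′
  (j ∷ t) ++ₜ t′ = j ∷ (t ++ₜ t′)

  trail-reach : ∀ {f u v es} → Trail f u v es → Reach f Every u v
  trail-reach []      = ε
  trail-reach (j ∷ t) = (_ , tt , j) ◅ trail-reach t

  data Split (f : State) (u v : V) (es : List E) (x : V) : Set where
    split-at : ∀ {es₁ es₂} → Trail f u x es₁ → Trail f x v es₂ → es ≡ es₁ ++ es₂ → Split f u v es x

  split-cons : ∀ {f u v w e es x} → Joins f e u v → Split f v w es x → Split f u w (e ∷ es) x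
  split-cons j (split-at t₁ t₂ refl) = split-at (j ∷ t₁) t₂ refl

  split-here : ∀ {f u v es} → Trail f u v es → Split f u v es u
  split-here t = split-at [] t refl

  visits : ∀ {f u v es e x y} → Trail f u v es → e ∈ₗ es → Joins f e x y → Split f u v es x
  visits (j ∷ t) (here refl) k with joins-unique j k
  ... | inj₁ (refl , _) = split-here (j ∷ t)
  ... | inj₂ (_ , refl) = split-cons j (split-here t)
  visits (j ∷ t) (there e∈) k = split-cons j (visits t e∈ k)

  trail-parity : ∀ {f u v es} S → Trail f u v es → xor-list (crossing f S) es ≡ S u xor S v
  trail-parity {u = u} S [] = sym (xor-same (S u))
  trail-parity {f} {u} {w} S (_∷_ {v = v} j t) =
    trans (cong₂ _xor_ (joins-crossing S j) (trail-parity S t))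
      (xor-telescope false (S u) (S v) (S w))

  Fresh : State → V → V → List E → Set
  Fresh f u v es = ∃ λ e → All (e ≢_) es × ∃ λ x → ∃ λ y → Joins f e y x × Split f u v es x

  -- Read backwards from `u`, the path stays on vertices of the trail as long as its edges belong to
  -- the trail, and its first other edge is fresh.
  touch : ∀ {f u v es x} → Trail f u v es → Reach f Every x u → Split f u v es x ⊎ Fresh f u v es
  touch t ε = inj₁ (split-here t)
  touch {es = es} t ((e , _ , j) ◅ ρ) with touch t ρ
  ... | inj₂ new = inj₂ new
  ... | inj₁ sp with e ∈ₗ? es
  ...   | yes e∈ = inj₁ (visits t e∈ j)
  ...   | no e∉  = inj₂ (e , ¬Any⇒All¬ es e∉ , _ , _ , j , sp)

  unique-length : ∀ {es : List E} → Unique es → length es ≤ m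
  unique-length {es} u = injective⇒≤ {f = lookup es} (unique⇒lookup-injective u)

  module Hierholzer {f : State} (even : Even f) (connected : Connected f) where

    Closed : Set
    Closed = ∃ λ u → ∃ λ es → Trail f u u es × Unique es × ∀ e → e ∈ₗ es

    mutual
      tour : ∀ k {u v es} → Trail f u v es → Unique es → (∀ e → Reach f Every (p (f e)) u) →
             m ≤ k + length es → Closed
      tour k {u} {v} {es} t unique home bound with u ≟ v
      ... | no u≢v with odd-rest (crossing f (δ u)) unique (cong₂ _xor_ (even (δ u))
                (trans (trail-parity (δ u) t) (cong₂ _xor_ (δ-self u) (δ-other (u≢v ∘ sym)))))
      ...   | e , new , te = longer k t unique home bound new (joins-sym (proj₂ (crossing-joins f te)))
      tour k {u} {_} {es} t unique home bound | yes refl with any? (λ e → ¬? (e ∈ₗ? es))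
      ... | no none = u , es , t , unique , λ e → decidable-stable (e ∈ₗ? es) λ e∉ → none (e , e∉)
      ... | yes (e , e∉) = rotated (fresh (touch t (home e)))
        where
        fresh : Split f u u es (p (f e)) ⊎ Fresh f u u es → Fresh f u u es
        fresh (inj₁ sp)  = e , ¬Any⇒All¬ es e∉ , _ , _ , joins bwd , sp
        fresh (inj₂ new) = new
        rotated : Fresh f u u es → Closed
        rotated (e , new , x , y , j , split-at {es₁} {es₂} t₁ t₂ refl) =
          longer k (t₂ ++ₜ t₁) (Unique-resp-↭ (++-comm es₁ es₂) unique)
            (λ e → home e ◅◅ trail-reach t₁)
            (subst (λ l → m ≤ k + l)
              (trans (length-++ es₁) (trans (+-comm (length es₁) _) (sym (length-++ es₂)))) bound)
            (++⁺ (++⁻ʳ es₁ new) (++⁻ˡ es₁ new)) j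

      longer : ∀ k {u v es e y} → Trail f u v es → Unique es → (∀ e → Reach f Every (p (f e)) u) →
               m ≤ k + length es → All (e ≢_) es → Joins f e y u → Closed
      -- Without fuel the trail already has at least `m` edges, so a new one would exceed the number
      -- of all edges.
      longer zero {es = es} {e} t unique home bound new j =
        ⊥-elim (<⇒≱ (unique-length {e ∷ es} (new ∷ unique)) bound)
      longer (suc k) {es = es} t unique home bound new j =
        tour k (j ∷ t) (new ∷ unique) (λ e → home e ◅◅ link tt (joins-sym j))
          (≤-trans bound (≤-reflexive (sym (+-suc k (length es)))))

    closed-trail : E → Closed
    closed-trail e = tour m [] [] (λ e′ → connected e′ e) (m≤m+n m 0)

  -- From a closed trail to an Euler tour

  vertices : ∀ {f u v es} → Trail f u v es → Fin (suc (length es)) → V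
  vertices {u = u} _       zero    = u
  vertices         (j ∷ t) (suc i) = vertices t i

  vertices-joins : ∀ {f u v es} (t : Trail f u v es) i →
                   Joins f (lookup es i) (vertices t (inject₁ i)) (vertices t (suc i))
  vertices-joins (j ∷ [])       zero    = j
  vertices-joins (j ∷ (_ ∷ _))  zero    = j
  vertices-joins (j ∷ t)        (suc i) = vertices-joins t i

  vertices-last : ∀ {f u v es} (t : Trail f u v es) → vertices t (fromℕ (length es)) ≡ v
  vertices-last []      = refl
  vertices-last (j ∷ t) = vertices-last t

  vertices-first : ∀ {f u v es} (t : Trail f u v es) → vertices t zero ≡ u
  vertices-first []      = refl
  vertices-first (j ∷ t) = refl

other-index : ∀ {k} → 2 ≤ k → (i : Fin k) → ∃ (_≢ i)
other-index (s≤s (s≤s _)) zero    = suc zero , λ ()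
other-index (s≤s (s≤s _)) (suc i) = zero , λ ()

module _ (H : Hypergraph) (long : 2 ≤ m H) where
  open Orderings (edge H)

  closed-trail⇒tour : ∀ {f u es} → Trail f u u es → Unique es → (∀ e → e ∈ₗ es) → EulerTour H
  closed-trail⇒tour {f} {u} {es} t unique complete =
    -- An Euler tour has length `m H` by definition, whereas the trail has `length es` edges. These
    -- agree because the trail contains every edge exactly once.
    subst (λ k → Σ (ClosedWalk H k) λ W → Bijective _≡_ _≡_ (ClosedWalk.edg W)) length≡m
      (walk , injective , surjective)
    where
    length≡m : length es ≡ m H
    length≡m = ≤-antisym (unique-length unique) (injective⇒≤ {f = λ e → Any.index (complete e)} λ {e} {e′} eq →
      trans (lookup-index (complete e)) (trans (cong (lookup es) eq) (sym (lookup-index (complete e′)))))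
    walk : ClosedWalk H (length es)
    walk = record
      { vtx      = vertices t
      ; edg      = lookup es
      ; incid₁   = λ i → joins-∈ (vertices-joins t i)
      ; incid₂   = λ i → joins-∈ (joins-sym (vertices-joins t i))
      ; distinct = λ i → joins-≢ (vertices-joins t i)
      ; closed   = trans (vertices-first t) (sym (vertices-last t))
      ; long     = subst (2 ≤_) (sym length≡m) long
      }
    injective : ∀ {i j} → lookup es i ≡ lookup es j → i ≡ j
    injective = unique⇒lookup-injective unique
    surjective : ∀ e → ∃ λ i → ∀ {j} → j ≡ i → lookup es j ≡ e
    surjective e = Any.index (complete e) , λ { refl → sym (lookup-index (complete e)) }

  connected-even⇒tour : E → (∃ λ f → Even f × Connected f) → EulerTour H
  connected-even⇒tour e (f , even , connected) with Hierholzer.closed-trail even connected e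
  ... | _ , _ , t , unique , complete = closed-trail⇒tour t unique complete

  covering⇒tour : Covering → State → EulerTour H
  covering⇒tour cover τ =
    connected-even⇒tour first (connected-state cover first (Existence.even-exists cover (other-index long) τ first))
    where
    first : E
    first = fromℕ< (≤-trans (s≤s z≤n) long)

theorem3p1 : (H : Hypergraph) → Covering3 H → 2 ≤ m H → Eulerian H
theorem3p1 H (uniform , _ , cover) long = inj₂ (covering⇒tour H long cover λ e → three (edge H e) (uniform e))
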